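{- Let $0<p<1$ and let $X_1,\ldots,X_n$ be independent Bernoulli random variables, each following the same distribution as a random variable $X\sim b(p)$. Let $S_n=\sum_{i=1}^n X_i$. Then, for any $r$ such that $p<r<1$, $$P(S_n\ge rn)\le\exp\left(-2n(r-p)^2\right).$$
   Context: $b(p)$ denotes the Bernoulli distribution with $P(X=1)=p$, $P(X=0)=1-p$. Here $n\ge 1$ is an integer. -}

module Defs where

open import Algebra.Bundles using (CommutativeRing)
import Algebra.Definitions.RawMonoid as RawMonoidDefinitions
import Algebra.Properties.AbelianGroup as AbelianGroupProperties
import Algebra.Properties.Monoid.Mult as MonoidMult
import Algebra.Properties.Ring as RingProperties
open import Data.Fin.Base using (Fin; zero; suc)
open import Data.Nat.Base as ℕ using (ℕ; zero; suc)
import Data.Nat.Properties as ℕₚ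
open import Data.Product.Base using (_×_; _,_; ∃-syntax; proj₁; proj₂)
open import Data.Sum.Base using (inj₁; inj₂; [_,_]′)
open import Data.Unit.Polymorphic.Base using (tt)
open import Data.Vec.Functional using (Vector)
open import Function.Base using (_∘_; const)
open import Level using (Level; _⊔_) renaming (suc to lsuc)
open import Relation.Binary.Bundles using (Poset)
import Relation.Binary.Construct.NonStrictToStrict as Strict
open import Relation.Binary.Core using (Rel)
open import Relation.Binary.PropositionalEquality.Core as ≡ using (_≢_)
import Relation.Binary.Reasoning.PartialOrder as PartialOrderReasoning
open import Relation.Binary.Structures using (IsDecTotalOrder)
open import Relation.Nullary.Decidable using (Dec; yes; no)
open import Relation.Nullary.Negation using (¬_; contradiction)
open import Relation.Unary using (Pred; _⊢_; _≐_; _∩_; ∁; ⋃; ⋂; Empty)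
open import Relation.Unary.Polymorphic using (U)

-- The real numbers, axiomatised as an Archimedean, Cauchy-complete ordered
-- field; classically these axioms determine ℝ up to isomorphism.  The order is
-- total and decidable, as it is in classical mathematics.

record RealField c ℓ : Set (lsuc (c ⊔ ℓ)) where
  field
    commutativeRing : CommutativeRing c ℓ

  open CommutativeRing commutativeRing public hiding (zero)

  infix 4 _≤_

  field
    _≤_             : Rel Carrier ℓ
    isDecTotalOrder : IsDecTotalOrder _≈_ _≤_
    +-monoʳ-≤       : ∀ x {y z} → y ≤ z → x + y ≤ x + z
    *-nonneg        : ∀ {x y} → 0# ≤ x → 0# ≤ y → 0# ≤ x * y
    1≉0             : ¬ 1# ≈ 0#
    inverse         : ∀ x → ¬ x ≈ 0# → ∃[ y ] x * y ≈ 1#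

  open Strict _≈_ _≤_ public using (_<_)

  fromℕ : ℕ → Carrier
  fromℕ n = RawMonoidDefinitions._×_ +-rawMonoid n 1#

  -- |x - y| < ε
  Close : Carrier → Rel Carrier ℓ
  Close ε x y = x - y < ε × y - x < ε

  Cauchy : (ℕ → Carrier) → Set (c ⊔ ℓ)
  Cauchy s = ∀ ε → 0# < ε → ∃[ N ] (∀ m n → N ℕ.≤ m → N ℕ.≤ n → Close ε (s m) (s n))

  infix 4 _ConvergesTo_

  _ConvergesTo_ : (ℕ → Carrier) → Carrier → Set (c ⊔ ℓ)
  s ConvergesTo l = ∀ ε → 0# < ε → ∃[ N ] (∀ n → N ℕ.≤ n → Close ε (s n) l)

  field
    archimedean : ∀ x → ∃[ n ] x ≤ fromℕ n
    complete    : ∀ s → Cauchy s → ∃[ l ] s ConvergesTo l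

  partialSums : (ℕ → Carrier) → ℕ → Carrier
  partialSums a zero    = 0#
  partialSums a (suc n) = partialSums a n + a n

  infixr 8 _²

  _² : Carrier → Carrier
  x ² = x * x

module RealProperties {c ℓ} (ℝ : RealField c ℓ) where

  open RealField ℝ
  open IsDecTotalOrder isDecTotalOrder public
    using (_≟_; _≤?_; total; antisym; isPartialOrder; ≤-respʳ-≈; ≤-respˡ-≈)
    renaming (refl to ≤-refl; trans to ≤-trans; reflexive to ≤-reflexive)
  open AbelianGroupProperties +-abelianGroup
    using ()
    renaming ( ⁻¹-involutive to -‿involutive; ε⁻¹≈ε to -0≈0
             ; ⁻¹-∙-comm to -‿+-comm; ⁻¹-anti-homo‿- to -‿flip)
  open RingProperties ring using (-‿distribˡ-*; -‿distribʳ-*)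

  poset : Poset c ℓ ℓ
  poset = record { isPartialOrder = isPartialOrder }

  open PartialOrderReasoning poset

  <⇒≱ : ∀ {x y} → x < y → ¬ (y ≤ x)
  <⇒≱ = Strict.<⇒≱ _≈_ _≤_ antisym

  ≰⇒> : ∀ {x y} → ¬ (x ≤ y) → y < x
  ≰⇒> = Strict.≰⇒> _≈_ _≤_ sym ≤-reflexive total

  +-mono-≤ : ∀ {x y u v} → x ≤ y → u ≤ v → x + u ≤ y + v
  +-mono-≤ {x} {y} {u} {v} x≤y u≤v = begin
    x + u  ≤⟨ +-monoʳ-≤ x u≤v ⟩
    x + v  ≈⟨ +-comm x v ⟩
    v + x  ≤⟨ +-monoʳ-≤ v x≤y ⟩
    v + y  ≈⟨ +-comm v y ⟩
    y + v  ∎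

  x+y-y : ∀ x y → (x + y) - y ≈ x
  x+y-y x y = trans (+-assoc x y (- y)) (trans (+-congˡ (-‿inverseʳ y)) (+-identityʳ x))

  x-y+y : ∀ x y → (x - y) + y ≈ x
  x-y+y x y = trans (+-assoc x (- y) y) (trans (+-congˡ (-‿inverseˡ y)) (+-identityʳ x))

  x+y-x : ∀ x y → (x + y) - x ≈ y
  x+y-x x y = trans (+-congʳ (+-comm x y)) (x+y-y y x)

  +-cancelˡ-≤ : ∀ x {y z} → x + y ≤ x + z → y ≤ z
  +-cancelˡ-≤ x {y} {z} le = begin
    y              ≈⟨ x+y-x x y ⟨
    (x + y) - x    ≤⟨ +-mono-≤ le ≤-refl ⟩
    (x + z) - x    ≈⟨ x+y-x x z ⟩
    z              ∎

  +-monoʳ-< : ∀ x {y z} → y < z → x + y < x + z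
  +-monoʳ-< x y<z = ≰⇒> (λ le → <⇒≱ y<z (+-cancelˡ-≤ x le))

  +-monoˡ-< : ∀ x {y z} → y < z → y + x < z + x
  +-monoˡ-< x {y} {z} y<z = begin-strict
    y + x  ≈⟨ +-comm y x ⟩
    x + y  <⟨ +-monoʳ-< x y<z ⟩
    x + z  ≈⟨ +-comm x z ⟩
    z + x  ∎

  +-mono-< : ∀ {x y u v} → x < y → u < v → x + u < y + v
  +-mono-< {x} {y} {u} {v} x<y u<v = begin-strict
    x + u  <⟨ +-monoʳ-< x u<v ⟩
    x + v  <⟨ +-monoˡ-< v x<y ⟩
    y + v  ∎

  x≤y⇒0≤y-x : ∀ {x y} → x ≤ y → 0# ≤ y - x
  x≤y⇒0≤y-x {x} {y} x≤y = begin
    0#     ≈⟨ -‿inverseʳ x ⟨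
    x - x  ≤⟨ +-mono-≤ x≤y ≤-refl ⟩
    y - x  ∎

  0≤y-x⇒x≤y : ∀ {x y} → 0# ≤ y - x → x ≤ y
  0≤y-x⇒x≤y {x} {y} le = begin
    x            ≈⟨ +-identityˡ x ⟨
    0# + x       ≤⟨ +-mono-≤ le ≤-refl ⟩
    (y - x) + x  ≈⟨ x-y+y y x ⟩
    y            ∎

  x≤0⇒0≤-x : ∀ {x} → x ≤ 0# → 0# ≤ - x
  x≤0⇒0≤-x {x} x≤0 = begin
    0#      ≤⟨ x≤y⇒0≤y-x x≤0 ⟩
    0# - x  ≈⟨ +-identityˡ (- x) ⟩
    - x     ∎

  0≤x⇒-x≤0 : ∀ {x} → 0# ≤ x → - x ≤ 0#
  0≤x⇒-x≤0 {x} 0≤x = begin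
    - x      ≈⟨ +-identityʳ (- x) ⟨
    - x + 0# ≤⟨ +-monoʳ-≤ (- x) 0≤x ⟩
    - x + x  ≈⟨ -‿inverseˡ x ⟩
    0#       ∎

  *-monoˡ-≤ : ∀ {z} → 0# ≤ z → ∀ {x y} → x ≤ y → z * x ≤ z * y
  *-monoˡ-≤ {z} 0≤z {x} {y} x≤y = 0≤y-x⇒x≤y (begin
    0#             ≤⟨ *-nonneg 0≤z (x≤y⇒0≤y-x x≤y) ⟩
    z * (y - x)    ≈⟨ distribˡ z y (- x) ⟩
    z * y + z * - x ≈⟨ +-congˡ (-‿distribʳ-* z x) ⟨
    z * y - z * x  ∎)

  *-monoʳ-≤ : ∀ {z} → 0# ≤ z → ∀ {x y} → x ≤ y → x * z ≤ y * z
  *-monoʳ-≤ {z} 0≤z {x} {y} x≤y = begin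
    x * z  ≈⟨ *-comm x z ⟩
    z * x  ≤⟨ *-monoˡ-≤ 0≤z x≤y ⟩
    z * y  ≈⟨ *-comm z y ⟩
    y * z  ∎

  *-monoˡ-< : ∀ {z} → 0# < z → ∀ {x y} → x < y → z * x < z * y
  *-monoˡ-< {z} (0≤z , 0≉z) {x} {y} (x≤y , x≉y) =
    *-monoˡ-≤ 0≤z x≤y , λ eq → x≉y (trans (sym (cancel x)) (trans (*-congˡ eq) (cancel y)))
    where
    z⁻¹ = inverse z (0≉z ∘ sym)
    cancel : ∀ u → proj₁ z⁻¹ * (z * u) ≈ u
    cancel u = trans (sym (*-assoc _ z u))
      (trans (*-congʳ (trans (*-comm _ z) (proj₂ z⁻¹))) (*-identityˡ u))

  0≤1 : 0# ≤ 1#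
  0≤1 with total 0# 1#
  ... | inj₁ le = le
  ... | inj₂ le = begin
    0#           ≤⟨ *-nonneg (x≤0⇒0≤-x le) (x≤0⇒0≤-x le) ⟩
    - 1# * - 1#  ≈⟨ -‿distribˡ-* 1# (- 1#) ⟨
    - (1# * - 1#) ≈⟨ -‿cong (*-identityˡ (- 1#)) ⟩
    - - 1#       ≈⟨ -‿involutive 1# ⟩
    1#           ∎

  0<1 : 0# < 1#
  0<1 = 0≤1 , 1≉0 ∘ sym

  inverse-pos : ∀ {x y} → 0# < x → x * y ≈ 1# → 0# < y
  inverse-pos {x} {y} (0≤x , _) xy≈1 = ≰⇒> λ y≤0 → <⇒≱ 0<1 (begin
    1#     ≈⟨ xy≈1 ⟨
    x * y  ≤⟨ *-monoˡ-≤ 0≤x y≤0 ⟩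
    x * 0# ≈⟨ zeroʳ x ⟩
    0#     ∎)

  x<1+x : ∀ x → x < 1# + x
  x<1+x x = begin-strict
    x       ≈⟨ +-identityˡ x ⟨
    0# + x  <⟨ +-monoˡ-< x 0<1 ⟩
    1# + x  ∎

  0≤fromℕ : ∀ n → 0# ≤ fromℕ n
  0≤fromℕ zero    = ≤-refl
  0≤fromℕ (suc n) = ≤-trans (0≤fromℕ n) (proj₁ (x<1+x (fromℕ n)))

  0<fromℕ-suc : ∀ n → 0# < fromℕ (suc n)
  0<fromℕ-suc n = begin-strict
    0#             ≤⟨ 0≤fromℕ n ⟩
    fromℕ n        <⟨ x<1+x (fromℕ n) ⟩
    fromℕ (suc n)  ∎

  fromℕ-mono : ∀ {m n} → m ℕ.≤ n → fromℕ m ≤ fromℕ n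
  fromℕ-mono {n = n} ℕ.z≤n = 0≤fromℕ n
  fromℕ-mono (ℕ.s≤s m≤n)   = +-monoʳ-≤ 1# (fromℕ-mono m≤n)

  fromℕ-+ : ∀ m n → fromℕ (m ℕ.+ n) ≈ fromℕ m + fromℕ n
  fromℕ-+ = MonoidMult.×-homo-+ +-monoid 1#

  inverse-suc : ∀ n → ∃[ y ] fromℕ (suc n) * y ≈ 1#
  inverse-suc n = inverse (fromℕ (suc n)) (proj₂ (0<fromℕ-suc n) ∘ sym)

  1/1+ : ℕ → Carrier
  1/1+ n = proj₁ (inverse-suc n)

  0<1/1+ : ∀ n → 0# < 1/1+ n
  0<1/1+ n = inverse-pos (0<fromℕ-suc n) (proj₂ (inverse-suc n))

  archimedean-< : ∀ {ε} → 0# < ε → ∀ x → ∃[ n ] x < ε * fromℕ (suc n)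
  archimedean-< {ε} 0<ε x = n , (begin-strict
    x                       ≈⟨ *-identityˡ x ⟨
    1# * x                  ≈⟨ *-congʳ (proj₂ e) ⟨
    (ε * proj₁ e) * x       ≈⟨ *-assoc ε (proj₁ e) x ⟩
    ε * (proj₁ e * x)       ≤⟨ *-monoˡ-≤ (proj₁ 0<ε) (proj₂ bound) ⟩
    ε * fromℕ n             <⟨ *-monoˡ-< 0<ε (x<1+x (fromℕ n)) ⟩
    ε * fromℕ (suc n)       ∎)
    where
    e     = inverse ε (proj₂ 0<ε ∘ sym)
    bound = archimedean (proj₁ e * x)
    n     = proj₁ bound

  ∃1/1+< : ∀ {ε} → 0# < ε → ∃[ n ] 1/1+ n < ε
  ∃1/1+< {ε} 0<ε with archimedean-< 0<ε 1#
  ... | n , 1<εn = n , (begin-strict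
    1/1+ n                         ≈⟨ *-identityʳ _ ⟨
    1/1+ n * 1#                    <⟨ *-monoˡ-< (0<1/1+ n) 1<εn ⟩
    1/1+ n * (ε * fromℕ (suc n))   ≈⟨ *-comm _ _ ⟩
    (ε * fromℕ (suc n)) * 1/1+ n   ≈⟨ *-assoc _ _ _ ⟩
    ε * (fromℕ (suc n) * 1/1+ n)   ≈⟨ *-congˡ (proj₂ (inverse-suc n)) ⟩
    ε * 1#                         ≈⟨ *-identityʳ ε ⟩
    ε                              ∎)

  frac : ℕ → ℕ → ℕ → Carrier
  frac m k j = fromℕ m * 1/1+ k - fromℕ j

  last-true : ∀ {a} {Q : Pred ℕ a} → (∀ n → Dec (Q n)) →
              ∀ M → Q 0 → ¬ Q M → ∃[ m ] (Q m × ¬ Q (suc m))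
  last-true Q? zero    q0 ¬qM = contradiction q0 ¬qM
  last-true Q? (suc M) q0 ¬qM with Q? M
  ... | yes qM  = M , qM , ¬qM
  ... | no  ¬qM′ = last-true Q? M q0 ¬qM′

  dense : ∀ {u v} → u < v → ∃[ m ] ∃[ k ] ∃[ j ] (u < frac m k j × frac m k j < v)
  dense {u} {v} u<v = suc m , k , j , ≰⇒> (proj₂ (proj₂ found)) , (begin-strict
    frac (suc m) k j          ≈⟨ step ⟩
    frac m k j + 1/1+ k       ≤⟨ +-mono-≤ (proj₁ (proj₂ found)) ≤-refl ⟩
    u + 1/1+ k                <⟨ +-monoʳ-< u (proj₂ small) ⟩
    u + (v - u)               ≈⟨ +-assoc u v (- u) ⟨
    (u + v) - u               ≈⟨ x+y-x u v ⟩
    v                         ∎)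
    where
    0<v-u : 0# < v - u
    0<v-u = begin-strict
      0#     ≈⟨ -‿inverseʳ u ⟨
      u - u  <⟨ +-monoˡ-< (- u) u<v ⟩
      v - u  ∎
    small = ∃1/1+< 0<v-u
    k = proj₁ small
    low = archimedean (- u)
    j = proj₁ low
    high = archimedean-< (0<1/1+ k) (u + fromℕ j)
    first : frac 0 k j ≤ u
    first = begin
      0# * 1/1+ k - fromℕ j  ≈⟨ +-congʳ (zeroˡ _) ⟩
      0# - fromℕ j           ≤⟨ +-mono-≤ (x≤y⇒0≤y-x (proj₂ low)) ≤-refl ⟩
      (fromℕ j - - u) - fromℕ j ≈⟨ x+y-x (fromℕ j) (- - u) ⟩
      - - u                  ≈⟨ -‿involutive u ⟩
      u                      ∎
    last : ¬ (frac (suc (proj₁ high)) k j ≤ u)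
    last le = <⇒≱ (proj₂ high) (begin
      1/1+ k * fromℕ (suc (proj₁ high))  ≈⟨ *-comm _ _ ⟩
      fromℕ (suc (proj₁ high)) * 1/1+ k  ≈⟨ x-y+y _ (fromℕ j) ⟨
      frac (suc (proj₁ high)) k j + fromℕ j ≤⟨ +-mono-≤ le ≤-refl ⟩
      u + fromℕ j                        ∎)
    found = last-true (λ i → frac i k j ≤? u) (suc (proj₁ high)) first last
    m = proj₁ found
    step : frac (suc m) k j ≈ frac m k j + 1/1+ k
    step = begin-equality
      (1# + fromℕ m) * 1/1+ k - fromℕ j          ≈⟨ +-congʳ (distribʳ _ 1# (fromℕ m)) ⟩
      (1# * 1/1+ k + fromℕ m * 1/1+ k) - fromℕ j ≈⟨ +-assoc _ _ _ ⟩
      1# * 1/1+ k + frac m k j                   ≈⟨ +-comm _ _ ⟩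
      frac m k j + 1# * 1/1+ k                   ≈⟨ +-congˡ (*-identityˡ _) ⟩
      frac m k j + 1/1+ k                        ∎

  -- |x| ≤ b
  Bounded : Carrier → Carrier → Set ℓ
  Bounded x b = x ≤ b × - x ≤ b

  ∣_∣ : Carrier → Carrier
  ∣ x ∣ = [ const x , const (- x) ]′ (total 0# x)

  bounded-∣∣ : ∀ x → Bounded x ∣ x ∣
  bounded-∣∣ x with total 0# x
  ... | inj₁ 0≤x = ≤-refl , ≤-trans (0≤x⇒-x≤0 0≤x) 0≤x
  ... | inj₂ x≤0 = ≤-trans x≤0 (x≤0⇒0≤-x x≤0) , ≤-refl

  0≤∣∣ : ∀ x → 0# ≤ ∣ x ∣
  0≤∣∣ x with total 0# x
  ... | inj₁ 0≤x = 0≤x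
  ... | inj₂ x≤0 = x≤0⇒0≤-x x≤0

  bounded-resp : ∀ {x y b} → x ≈ y → Bounded x b → Bounded y b
  bounded-resp x≈y (p , q) = ≤-respˡ-≈ x≈y p , ≤-respˡ-≈ (-‿cong x≈y) q

  bounded-≤ : ∀ {x b d} → b ≤ d → Bounded x b → Bounded x d
  bounded-≤ b≤d (p , q) = ≤-trans p b≤d , ≤-trans q b≤d

  bounded-neg : ∀ {x b} → Bounded x b → Bounded (- x) b
  bounded-neg {x} (p , q) = q , ≤-respˡ-≈ (sym (-‿involutive x)) p

  bounded-+ : ∀ {x y b d} → Bounded x b → Bounded y d → Bounded (x + y) (b + d)
  bounded-+ {x} {y} (p , q) (p′ , q′) =
    +-mono-≤ p p′ , ≤-respˡ-≈ (-‿+-comm x y) (+-mono-≤ q q′)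

  bounded-nonneg : ∀ {x b} → Bounded x b → 0# ≤ b
  bounded-nonneg {x} (p , q) with total 0# x
  ... | inj₁ 0≤x = ≤-trans 0≤x p
  ... | inj₂ x≤0 = ≤-trans (x≤0⇒0≤-x x≤0) q

  bounded-*-nonneg : ∀ {x y b} → 0# ≤ x → Bounded y b → Bounded (x * y) (x * b)
  bounded-*-nonneg {x} {y} 0≤x (p , q) =
    *-monoˡ-≤ 0≤x p , ≤-respˡ-≈ (sym (-‿distribʳ-* x y)) (*-monoˡ-≤ 0≤x q)

  bounded-* : ∀ x {y b} → Bounded y b → Bounded (x * y) (∣ x ∣ * b)
  bounded-* x {y} bd with total 0# x
  ... | inj₁ 0≤x = bounded-*-nonneg 0≤x bd
  ... | inj₂ x≤0 = bounded-resp
    (trans (-‿cong (sym (-‿distribˡ-* x y))) (-‿involutive (x * y)))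
    (bounded-neg (bounded-*-nonneg (x≤0⇒0≤-x x≤0) bd))

  ∣∣-double : ∀ {x b} → Bounded (x + x) b → ∣ x ∣ + ∣ x ∣ ≤ b
  ∣∣-double {x} (p , q) with total 0# x
  ... | inj₁ _ = p
  ... | inj₂ _ = ≤-respˡ-≈ (sym (-‿+-comm x x)) q

  -- x ^ k / k !
  expTerm : Carrier → ℕ → Carrier
  expTerm x zero    = 1#
  expTerm x (suc k) = expTerm x k * (x * 1/1+ k)

  module ExpCauchy (x : Carrier) where

    t s : ℕ → Carrier
    t = expTerm x
    s = partialSums t

    d : ℕ → Carrier
    d k = ∣ t k ∣

    K : ℕ
    K = proj₁ (archimedean (∣ x ∣ + ∣ x ∣))

    halving : ∀ k → K ℕ.≤ k → d (suc k) + d (suc k) ≤ d k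
    halving k K≤k = ∣∣-double (bounded-resp (distribˡ (t k) y y)
      (bounded-≤ (≤-reflexive (*-identityʳ (d k))) (bounded-* (t k) y+y)))
      where
      y = x * 1/1+ k
      x+x : Bounded (x + x) (fromℕ (suc k))
      x+x = bounded-≤
        (≤-trans (proj₂ (archimedean (∣ x ∣ + ∣ x ∣))) (fromℕ-mono (ℕₚ.m≤n⇒m≤1+n K≤k)))
        (bounded-+ (bounded-∣∣ x) (bounded-∣∣ x))
      y+y : Bounded (y + y) 1#
      y+y = bounded-≤
        (≤-reflexive (trans (*-comm _ _) (proj₂ (inverse-suc k))))
        (bounded-resp (trans (*-comm _ _) (distribʳ (1/1+ k) x x))
          (bounded-*-nonneg (proj₁ (0<1/1+ k)) x+x))

    tail : ∀ i m → K ℕ.≤ m → Bounded (s (m ℕ.+ i) - s m) (d m + d m)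
    tail zero m K≤m rewrite ℕₚ.+-identityʳ m =
      bounded-resp (sym (-‿inverseʳ (s m)))
        (0≤2d , ≤-respˡ-≈ (sym -0≈0) 0≤2d)
      where
      0≤2d : 0# ≤ d m + d m
      0≤2d = ≤-respˡ-≈ (+-identityʳ 0#) (+-mono-≤ (0≤∣∣ (t m)) (0≤∣∣ (t m)))
    tail (suc i) m K≤m rewrite ℕₚ.+-suc m i =
      bounded-resp split
        (bounded-≤ (+-mono-≤ (halving m K≤m) ≤-refl)
          (bounded-+ (tail i (suc m) (ℕₚ.m≤n⇒m≤1+n K≤m)) (bounded-∣∣ (t m))))
      where
      z = s (suc (m ℕ.+ i))
      split : (z - (s m + t m)) + t m ≈ z - s m
      split = begin-equality
        (z - (s m + t m)) + t m        ≈⟨ +-congʳ (+-congˡ (-‿+-comm (s m) (t m))) ⟨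
        (z + (- s m - t m)) + t m      ≈⟨ +-assoc _ _ _ ⟩
        z + ((- s m - t m) + t m)      ≈⟨ +-congˡ (x-y+y (- s m) (t m)) ⟩
        z - s m                        ∎

    decay : ∀ j → d (j ℕ.+ K) * fromℕ (suc j) ≤ d K
    decay zero    = ≤-reflexive (trans (*-congˡ (+-identityʳ 1#)) (*-identityʳ (d K)))
    decay (suc j) = begin
      d′ * fromℕ (suc (suc j))             ≤⟨ *-monoˡ-≤ (0≤∣∣ _) (+-mono-≤ 1≤n ≤-refl) ⟩
      d′ * (n + n)                         ≈⟨ distribˡ d′ n n ⟩
      d′ * n + d′ * n                      ≈⟨ distribʳ n d′ d′ ⟨
      (d′ + d′) * n                        ≤⟨ *-monoʳ-≤ (0≤fromℕ (suc j))
                                                (halving (j ℕ.+ K) (ℕₚ.m≤n+m K j)) ⟩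
      d (j ℕ.+ K) * n                      ≤⟨ decay j ⟩
      d K                                  ∎
      where
      d′ = d (suc (j ℕ.+ K))
      n  = fromℕ (suc j)
      1≤n : 1# ≤ n
      1≤n = begin
        1#             ≈⟨ +-identityʳ 1# ⟨
        1# + 0#        ≤⟨ +-monoʳ-≤ 1# (0≤fromℕ j) ⟩
        n              ∎

    near : ∀ {M} → K ℕ.≤ M → ∀ m → M ℕ.≤ m → Bounded (s m - s M) (d M + d M)
    near {M} K≤M m M≤m with ℕₚ.m≤n⇒∃[o]m+o≡n M≤m
    ... | i , ≡.refl = tail i M K≤M

    cauchy : Cauchy s
    cauchy ε 0<ε = M , λ m n M≤m M≤n → close m n M≤m M≤n , close n m M≤n M≤m
      where
      found = archimedean-< 0<ε (d K)
      j = proj₁ found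
      L = j ℕ.+ K
      M = suc (suc L)
      K≤L : K ℕ.≤ L
      K≤L = ℕₚ.m≤n+m K j
      K≤1+L = ℕₚ.m≤n⇒m≤1+n K≤L
      K≤M = ℕₚ.m≤n⇒m≤1+n K≤1+L
      dL<ε : d L < ε
      dL<ε = ≰⇒> λ ε≤d → <⇒≱ (proj₂ found)
        (≤-trans (*-monoʳ-≤ (0≤fromℕ (suc j)) ε≤d) (decay j))
      close : ∀ m n → M ℕ.≤ m → M ℕ.≤ n → s m - s n < ε
      close m n M≤m M≤n = begin-strict
        s m - s n                        ≈⟨ +-congʳ (x-y+y (s m) (s M)) ⟨
        ((s m - s M) + s M) - s n        ≈⟨ +-assoc _ _ _ ⟩
        (s m - s M) + (s M - s n)        ≈⟨ +-congˡ (-‿flip (s n) (s M)) ⟨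
        (s m - s M) - (s n - s M)        ≤⟨ +-mono-≤ (proj₁ (near K≤M m M≤m))
                                                     (proj₂ (near K≤M n M≤n)) ⟩
        (d M + d M) + (d M + d M)        ≤⟨ +-mono-≤ (halving (suc L) K≤1+L)
                                                     (halving (suc L) K≤1+L) ⟩
        d (suc L) + d (suc L)            ≤⟨ halving L K≤L ⟩
        d L                              <⟨ dL<ε ⟩
        ε                                ∎

  expSeries-cauchy : ∀ x → Cauchy (partialSums (expTerm x))
  expSeries-cauchy = ExpCauchy.cauchy

  exp : Carrier → Carrier
  exp x = proj₁ (complete (partialSums (expTerm x)) (expSeries-cauchy x))

  -- The σ-algebra generated by the half-lines (-∞ , a].  Closure under ⋂
  -- follows classically from the other rules; it is included because De Morgan
  -- is not available constructively.
  data Borel : Pred Carrier ℓ → Set (c ⊔ lsuc ℓ) where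
    half-line : ∀ a → Borel (_≤ a)
    ∁-borel   : ∀ {B} → Borel B → Borel (∁ B)
    ⋃-borel   : ∀ {B : ℕ → Pred Carrier ℓ} → (∀ i → Borel (B i)) → Borel (⋃ ℕ B)
    ⋂-borel   : ∀ {B : ℕ → Pred Carrier ℓ} → (∀ i → Borel (B i)) → Borel (⋂ ℕ B)
    ≐-borel   : ∀ {A B} → A ≐ B → Borel A → Borel B

  upper-half-line : ∀ a → Borel (a ≤_)
  upper-half-line a = ≐-borel (to , from) (⋂-borel λ k → ∁-borel (half-line (a - 1/1+ k)))
    where
    to : ∀ {x} → (∀ k → ¬ (x ≤ a - 1/1+ k)) → a ≤ x
    to {x} h with a ≤? x
    ... | yes a≤x = a≤x
    ... | no  a≰x = contradiction x≤a-1/k (h k)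
      where
      x<a : x < a
      x<a = ≰⇒> a≰x
      0<a-x : 0# < a - x
      0<a-x = begin-strict
        0#     ≈⟨ -‿inverseʳ x ⟨
        x - x  <⟨ +-monoˡ-< (- x) x<a ⟩
        a - x  ∎
      k = proj₁ (∃1/1+< 0<a-x)
      x≤a-1/k : x ≤ a - 1/1+ k
      x≤a-1/k = +-cancelˡ-≤ (1/1+ k) (begin
        1/1+ k + x             ≤⟨ +-mono-≤ (proj₁ (proj₂ (∃1/1+< 0<a-x))) ≤-refl ⟩
        (a - x) + x            ≈⟨ x-y+y a x ⟩
        a                      ≈⟨ x-y+y a (1/1+ k) ⟨
        (a - 1/1+ k) + 1/1+ k  ≈⟨ +-comm _ _ ⟩
        1/1+ k + (a - 1/1+ k)  ∎)
    from : ∀ {x} → a ≤ x → ∀ k → ¬ (x ≤ a - 1/1+ k)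
    from {x} a≤x k x≤ = <⇒≱ (0<1/1+ k) (+-cancelˡ-≤ (a - 1/1+ k) (begin
      (a - 1/1+ k) + 1/1+ k  ≈⟨ x-y+y a (1/1+ k) ⟩
      a                      ≤⟨ ≤-trans a≤x x≤ ⟩
      a - 1/1+ k             ≈⟨ +-identityʳ _ ⟨
      (a - 1/1+ k) + 0#      ∎))

  singleton : ∀ a → Borel (_≈ a)
  singleton a = ≐-borel (to , from) (⋂-borel {B = sides} sides-borel)
    where
    sides : ℕ → Pred Carrier ℓ
    sides zero    = _≤ a
    sides (suc _) = a ≤_
    sides-borel : ∀ i → Borel (sides i)
    sides-borel zero    = half-line a
    sides-borel (suc _) = upper-half-line a
    to : ∀ {x} → (∀ i → sides i x) → x ≈ a
    to h = antisym (h 0) (h 1)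
    from : ∀ {x} → x ≈ a → ∀ i → sides i x
    from x≈a zero    = ≤-reflexive x≈a
    from x≈a (suc _) = ≤-reflexive (sym x≈a)

module Probability {c ℓ} (ℝ : RealField c ℓ) where

  open RealField ℝ
  open RealProperties ℝ
  open PartialOrderReasoning poset

  -- As in Borel, closure under ⋂ is listed separately only for constructive
  -- reasons.
  record ProbabilitySpace o e : Set (c ⊔ lsuc (ℓ ⊔ o ⊔ e)) where
    field
      Ω       : Set o
      IsEvent : Pred Ω ℓ → Set e
      U-event : IsEvent U
      ∁-event : ∀ {A} → IsEvent A → IsEvent (∁ A)
      ⋃-event : ∀ {A : ℕ → Pred Ω ℓ} → (∀ i → IsEvent (A i)) → IsEvent (⋃ ℕ A)
      ⋂-event : ∀ {A : ℕ → Pred Ω ℓ} → (∀ i → IsEvent (A i)) → IsEvent (⋂ ℕ A)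
      ≐-event : ∀ {A B} → A ≐ B → IsEvent A → IsEvent B

      ℙ          : ∀ {A} → IsEvent A → Carrier
      ℙ-cong     : ∀ {A B} (a : IsEvent A) (b : IsEvent B) → A ≐ B → ℙ a ≈ ℙ b
      ℙ-nonneg   : ∀ {A} (a : IsEvent A) → 0# ≤ ℙ a
      ℙ-U        : ℙ U-event ≈ 1#
      ℙ-additive : ∀ {A : ℕ → Pred Ω ℓ} (a : ∀ i → IsEvent (A i)) →
                   (∀ {i j} → i ≢ j → Empty (A i ∩ A j)) →
                   partialSums (λ i → ℙ (a i)) ConvergesTo ℙ (⋃-event a)

    ∩-event : ∀ {A B} → IsEvent A → IsEvent B → IsEvent (A ∩ B)
    ∩-event {A} {B} a b = ≐-event ((λ h → h 0 , h 1) , from) (⋂-event {A = both} both-event)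
      where
      both : ℕ → Pred Ω ℓ
      both zero    = A
      both (suc _) = B
      both-event : ∀ i → IsEvent (both i)
      both-event zero    = a
      both-event (suc _) = b
      from : ∀ {ω} → A ω × B ω → ∀ i → both i ω
      from (p , q) zero    = p
      from (p , q) (suc _) = q

    ⋂ᶠ-event : ∀ {n} {A : Fin n → Pred Ω ℓ} → (∀ i → IsEvent (A i)) → IsEvent (⋂ (Fin n) A)
    ⋂ᶠ-event {zero}      a = ≐-event ((λ _ ()) , (λ _ → tt)) U-event
    ⋂ᶠ-event {suc n} {A} a = ≐-event (to , λ h → h zero , h ∘ suc)
                               (∩-event (a zero) (⋂ᶠ-event (a ∘ suc)))
      where
      to : ∀ {ω} → A zero ω × (∀ i → A (suc i) ω) → ∀ i → A i ω
      to (p , q) zero    = p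
      to (p , q) (suc i) = q i

    HalfLineMeasurable : (Ω → Carrier) → Set (c ⊔ e)
    HalfLineMeasurable f = ∀ a → IsEvent (λ ω → f ω ≤ a)

    half-line⇒borel : ∀ {f} → HalfLineMeasurable f → ∀ {B} → Borel B → IsEvent (f ⊢ B)
    half-line⇒borel m (half-line a)           = m a
    half-line⇒borel m (∁-borel b)             = ∁-event (half-line⇒borel m b)
    half-line⇒borel m (⋃-borel b)             = ⋃-event (λ i → half-line⇒borel m (b i))
    half-line⇒borel m (⋂-borel b)             = ⋂-event (λ i → half-line⇒borel m (b i))
    half-line⇒borel m (≐-borel (to , from) b) =
      ≐-event ((λ {ω} → to) , (λ {ω} → from)) (half-line⇒borel m b)

    -- {f + g ≤ a} is the complement of the union over rationals q of
    -- {f > q} ∩ {g > a - q}.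
    +-measurable : ∀ {f g} → HalfLineMeasurable f → HalfLineMeasurable g →
                   HalfLineMeasurable (λ ω → f ω + g ω)
    +-measurable {f} {g} mf mg a = ≐-event (to , from)
      (∁-event (⋃-event λ m → ⋃-event λ k → ⋃-event λ j →
        ∩-event (∁-event (mf (frac m k j))) (∁-event (mg (a - frac m k j)))))
      where
      Above : ℕ → ℕ → ℕ → Pred Ω ℓ
      Above m k j = ∁ (λ ω → f ω ≤ frac m k j) ∩ ∁ (λ ω → g ω ≤ a - frac m k j)

      to : ∀ {ω} → ¬ (∃[ m ] ∃[ k ] ∃[ j ] Above m k j ω) → f ω + g ω ≤ a
      to {ω} h with f ω + g ω ≤? a
      ... | yes le = le
      ... | no  gt = contradiction (m , k , j , f-above , g-above) h
        where
        a-g<f : a - g ω < f ω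
        a-g<f = begin-strict
          a - g ω              <⟨ +-monoˡ-< (- g ω) (≰⇒> gt) ⟩
          (f ω + g ω) - g ω    ≈⟨ x+y-y (f ω) (g ω) ⟩
          f ω                  ∎
        found = dense a-g<f
        m = proj₁ found
        k = proj₁ (proj₂ found)
        j = proj₁ (proj₂ (proj₂ found))
        q = frac m k j
        f-above : ¬ (f ω ≤ q)
        f-above = <⇒≱ (proj₂ (proj₂ (proj₂ (proj₂ found))))
        g-above : ¬ (g ω ≤ a - q)
        g-above le = <⇒≱ (proj₁ (proj₂ (proj₂ (proj₂ found)))) (+-cancelˡ-≤ (g ω) (begin
          g ω + q              ≤⟨ +-mono-≤ le ≤-refl ⟩
          (a - q) + q          ≈⟨ x-y+y a q ⟩
          a                    ≈⟨ x-y+y a (g ω) ⟨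
          (a - g ω) + g ω      ≈⟨ +-comm _ _ ⟩
          g ω + (a - g ω)      ∎))

      from : ∀ {ω} → f ω + g ω ≤ a → ¬ (∃[ m ] ∃[ k ] ∃[ j ] Above m k j ω)
      from {ω} le (m , k , j , f≰q , g≰a-q) = <⇒≱ (begin-strict
          a                    ≈⟨ x-y+y a q ⟨
          (a - q) + q          ≈⟨ +-comm _ _ ⟩
          q + (a - q)          <⟨ +-mono-< (≰⇒> f≰q) (≰⇒> g≰a-q) ⟩
          f ω + g ω            ∎) le
        where q = frac m k j

    const-measurable : ∀ x → HalfLineMeasurable (const x)
    const-measurable x a with x ≤? a
    ... | yes x≤a = ≐-event ((λ _ → x≤a) , (λ _ → tt)) U-event
    ... | no  x≰a = ≐-event ((λ ¬u → contradiction tt ¬u) , (λ x≤a → contradiction x≤a x≰a))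
                      (∁-event U-event)

    record RandomVariable : Set (c ⊔ lsuc ℓ ⊔ o ⊔ e) where
      field
        value      : Ω → Carrier
        measurable : ∀ {B} → Borel B → IsEvent (value ⊢ B)

    open RandomVariable public

    -- Pr X b is ℙ(X ∈ B), where b witnesses that B is Borel.
    Pr : RandomVariable → ∀ {B} → Borel B → Carrier
    Pr X b = ℙ (measurable X b)

    open RawMonoidDefinitions +-rawMonoid using (sum)
    open RawMonoidDefinitions *-rawMonoid using () renaming (sum to product)

    sum-measurable : ∀ {n} (X : Vector RandomVariable n) →
                     HalfLineMeasurable (λ ω → sum (λ i → value (X i) ω))
    sum-measurable {zero}  X = const-measurable 0#
    sum-measurable {suc n} X =
      +-measurable (λ a → measurable (X zero) (half-line a)) (sum-measurable (X ∘ suc))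

    ∑ : ∀ {n} → Vector RandomVariable n → RandomVariable
    ∑ X .value ω    = sum (λ i → value (X i) ω)
    ∑ X .measurable = half-line⇒borel (sum-measurable X)

    -- Taking some of the B i to be the whole line gives the product formula for
    -- subfamilies.
    Independent : ∀ {n} → Vector RandomVariable n → Set (c ⊔ lsuc ℓ)
    Independent {n} X = (B : Fin n → Pred Carrier ℓ) (b : ∀ i → Borel (B i)) →
      ℙ (⋂ᶠ-event (λ i → measurable (X i) (b i))) ≈ product (λ i → Pr (X i) (b i))

    -- X ∼ b(p); X is real-valued, so it may take other values on a null event.
    infix 4 _∼b_

    _∼b_ : RandomVariable → Carrier → Set ℓ
    X ∼b p = Pr X (singleton 1#) ≈ p × Pr X (singleton 0#) ≈ 1# - p

-- Chernoff's method with parameter 4(r - p): the indicator of {Sₙ ≥ rn} is at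
-- most exp (4(r - p)(Sₙ - rn)), so summing over the outcomes in {0,1}ⁿ reduces
-- the claim to Hoeffding's lemma
--   K(y) = p exp (4(1 - p)y) + (1 - p) exp (- 4py) ≤ exp (2y²)   for 0 ≤ y ≤ 1.
-- Derivatives are avoided as follows.  From cosh (2y) ≤ exp (2y²), compared
-- termwise, one gets K(2y) ≤ K(y)² exp (4y²).  Hence if K(y) ≤ exp ((2 + ε)y²)
-- on [0,1], the same holds with ε / 2, and some ε works because the linear terms
-- of K cancel.

module Submission where

open import Defs
import Algebra.Definitions.RawMonoid as RawMonoidDefinitions
import Algebra.Properties.AbelianGroup as AbelianGroupProperties
import Algebra.Properties.Ring as RingProperties
import Algebra.Properties.Semiring.Mult as SemiringMult
import Algebra.Solver.Ring as RingSolver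
open import Algebra.Solver.Ring.AlmostCommutativeRing
  using (AlmostCommutativeRing; _-Raw-AlmostCommutative⟶_; fromCommutativeRing)
open import Data.Bool.Base using (Bool; true; false)
open import Data.Fin.Base using (zero; suc)
open import Data.Integer.Base as ℤ using (ℤ; -[1+_]) renaming (+_ to +ℤ_)
import Data.Integer.Properties as ℤₚ
import Data.Maybe.Base as Maybe
open import Data.Nat.Base as ℕ using (ℕ; zero; suc) renaming (_≤_ to _≤ℕ_)
import Data.Nat.Properties as ℕₚ
open import Data.Product.Base using (_,_; ∃-syntax; proj₁; proj₂)
open import Data.Sum.Base using (inj₁; inj₂; [_,_]′)
open import Data.Unit.Polymorphic.Base using (tt)
open import Data.Vec.Functional using (Vector; []; _∷_)
open import Function.Base using (_∘_; id)
open import Relation.Binary.PropositionalEquality.Core as ≡ using (_≡_; _≢_)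
import Relation.Binary.Reasoning.PartialOrder as PartialOrderReasoning
import Relation.Binary.Reasoning.Setoid as SetoidReasoning
open import Relation.Nullary.Decidable using (yes; no; dec⇒maybe; _×-dec_; ¬?)
open import Relation.Nullary.Negation using (contradiction)
open import Relation.Unary using (Pred; Decidable; _⊢_; _≐_; _∩_; _∪_; _⊆_; ∁; ⋃; Empty)
open import Relation.Unary.Polymorphic using (U)

-- The constant 2 is forced by the doubling inequality: a bound a y² on log K at y becomes (a / 2 +
-- 1)(2y)² at 2y, and the map sending a to a / 2 + 1 fixes 2 and halves the distance to it. Doubling
-- alone cannot give the result, since a linear function b y in place of log K satisfies it with
-- room to spare; the second-order bound near 0 is what excludes this. No expectation is constructed
-- either. An event is cut along the values of X₁, ..., Xₙ, where values other than 0 and 1 occupy a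
-- null event, and only the probabilities of the resulting outcomes are compared with weights. As
-- the logic is constructive, ℙ is shown to be monotone only on decidable events; the argument
-- therefore carries decidability along, obtained from the decidable order and equality of the
-- reals.

-- Ring identities with integer coefficients.

module IntegerSolver {c ℓ} (ℝ : RealField c ℓ) where

  open RealField ℝ
  open RealProperties ℝ using (fromℕ-+)
  open AbelianGroupProperties +-abelianGroup using (⁻¹-∙-comm; ⁻¹-involutive; ε⁻¹≈ε)
  open RingProperties ring using (-‿distribˡ-*; -‿distribʳ-*)
  open SemiringMult semiring using (×1-homo-*)
  open SetoidReasoning setoid

  -- con (+ 1) has to denote 1#, whereas fromℕ 1 is 1# + 0#.
  fromℤ : ℤ → Carrier
  fromℤ (+ℤ 1)    = 1#
  fromℤ (+ℤ n)    = fromℕ n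
  fromℤ -[1+ n ] = - fromℕ (suc n)

  fromℤ-pos : ∀ n → fromℤ (+ℤ n) ≈ fromℕ n
  fromℤ-pos 0             = refl
  fromℤ-pos 1             = sym (+-identityʳ 1#)
  fromℤ-pos (suc (suc n)) = refl

  fromℤ-neg : ∀ i → fromℤ (ℤ.- i) ≈ - fromℤ i
  fromℤ-neg (+ℤ 0)             = sym ε⁻¹≈ε
  fromℤ-neg (+ℤ 1)             = -‿cong (+-identityʳ 1#)
  fromℤ-neg (+ℤ suc (suc n))   = refl
  fromℤ-neg -[1+ n ]          = trans (fromℤ-pos (suc n)) (sym (⁻¹-involutive _))

  fromℤ-⊖ : ∀ m n → fromℤ (m ℤ.⊖ n) ≈ fromℕ m - fromℕ n
  fromℤ-⊖ m       zero    = begin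
    fromℤ (+ℤ m)     ≈⟨ fromℤ-pos m ⟩
    fromℕ m          ≈⟨ +-identityʳ _ ⟨
    fromℕ m + 0#     ≈⟨ +-congˡ ε⁻¹≈ε ⟨
    fromℕ m - 0#     ∎
  fromℤ-⊖ zero    (suc n) = sym (+-identityˡ _)
  fromℤ-⊖ (suc m) (suc n) = begin
    fromℤ (suc m ℤ.⊖ suc n)               ≡⟨ ≡.cong fromℤ (ℤₚ.[1+m]⊖[1+n]≡m⊖n m n) ⟩
    fromℤ (m ℤ.⊖ n)                       ≈⟨ fromℤ-⊖ m n ⟩
    fromℕ m - fromℕ n                     ≈⟨ +-congʳ (+-identityʳ _) ⟨
    (fromℕ m + 0#) - fromℕ n              ≈⟨ +-congʳ (+-congˡ (-‿inverseʳ 1#)) ⟨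
    (fromℕ m + (1# - 1#)) - fromℕ n       ≈⟨ +-congʳ (+-assoc _ _ _) ⟨
    ((fromℕ m + 1#) - 1#) - fromℕ n       ≈⟨ +-assoc _ _ _ ⟩
    (fromℕ m + 1#) + (- 1# - fromℕ n)     ≈⟨ +-cong (+-comm _ _) (⁻¹-∙-comm _ _) ⟩
    fromℕ (suc m) - fromℕ (suc n)         ∎

  fromℤ-+ : ∀ i j → fromℤ (i ℤ.+ j) ≈ fromℤ i + fromℤ j
  fromℤ-+ (+ℤ m) (+ℤ n) = begin
    fromℤ (+ℤ (m ℕ.+ n))      ≈⟨ fromℤ-pos (m ℕ.+ n) ⟩
    fromℕ (m ℕ.+ n)           ≈⟨ fromℕ-+ m n ⟩
    fromℕ m + fromℕ n         ≈⟨ +-cong (fromℤ-pos m) (fromℤ-pos n) ⟨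
    fromℤ (+ℤ m) + fromℤ (+ℤ n) ∎
  fromℤ-+ (+ℤ m) -[1+ n ] = trans (fromℤ-⊖ m (suc n)) (+-congʳ (sym (fromℤ-pos m)))
  fromℤ-+ -[1+ m ] (+ℤ n) = trans (fromℤ-⊖ n (suc m))
    (trans (+-comm _ _) (+-congˡ (sym (fromℤ-pos n))))
  fromℤ-+ -[1+ m ] -[1+ n ] = begin
    - fromℕ (suc (suc (m ℕ.+ n)))          ≡⟨ ≡.cong (λ k → - fromℕ (suc k)) (ℕₚ.+-suc m n) ⟨
    - fromℕ (suc m ℕ.+ suc n)              ≈⟨ -‿cong (fromℕ-+ (suc m) (suc n)) ⟩
    - (fromℕ (suc m) + fromℕ (suc n))      ≈⟨ ⁻¹-∙-comm _ _ ⟨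
    - fromℕ (suc m) - fromℕ (suc n)        ∎

  fromℤ-*-pos : ∀ m n → fromℤ (+ℤ m ℤ.* +ℤ n) ≈ fromℤ (+ℤ m) * fromℤ (+ℤ n)
  fromℤ-*-pos m n = begin
    fromℤ (+ℤ m ℤ.* +ℤ n)      ≡⟨ ≡.cong fromℤ (ℤₚ.pos-* m n) ⟨
    fromℤ (+ℤ (m ℕ.* n))      ≈⟨ fromℤ-pos (m ℕ.* n) ⟩
    fromℕ (m ℕ.* n)           ≈⟨ ×1-homo-* m n ⟩
    fromℕ m * fromℕ n         ≈⟨ *-cong (fromℤ-pos m) (fromℤ-pos n) ⟨
    fromℤ (+ℤ m) * fromℤ (+ℤ n) ∎

  fromℤ-*-posˡ : ∀ m j → fromℤ (+ℤ m ℤ.* j) ≈ fromℤ (+ℤ m) * fromℤ j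
  fromℤ-*-posˡ m (+ℤ n)   = fromℤ-*-pos m n
  fromℤ-*-posˡ m -[1+ n ] = begin
    fromℤ (+ℤ m ℤ.* -[1+ n ])               ≡⟨ ≡.cong fromℤ (ℤₚ.neg-distribʳ-* (+ℤ m) (+ℤ suc n)) ⟨
    fromℤ (ℤ.- (+ℤ m ℤ.* +ℤ suc n))         ≈⟨ fromℤ-neg (+ℤ m ℤ.* +ℤ suc n) ⟩
    - fromℤ (+ℤ m ℤ.* +ℤ suc n)             ≈⟨ -‿cong (fromℤ-*-pos m (suc n)) ⟩
    - (fromℤ (+ℤ m) * fromℤ (+ℤ suc n))     ≈⟨ -‿distribʳ-* _ _ ⟩
    fromℤ (+ℤ m) * - fromℤ (+ℤ suc n)       ≈⟨ *-congˡ (fromℤ-neg (+ℤ suc n)) ⟨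
    fromℤ (+ℤ m) * fromℤ -[1+ n ]           ∎

  fromℤ-* : ∀ i j → fromℤ (i ℤ.* j) ≈ fromℤ i * fromℤ j
  fromℤ-* (+ℤ m)   j = fromℤ-*-posˡ m j
  fromℤ-* -[1+ m ] j = begin
    fromℤ (-[1+ m ] ℤ.* j)            ≡⟨ ≡.cong fromℤ (ℤₚ.neg-distribˡ-* (+ℤ suc m) j) ⟨
    fromℤ (ℤ.- (+ℤ suc m ℤ.* j))      ≈⟨ fromℤ-neg (+ℤ suc m ℤ.* j) ⟩
    - fromℤ (+ℤ suc m ℤ.* j)          ≈⟨ -‿cong (fromℤ-*-posˡ (suc m) j) ⟩
    - (fromℤ (+ℤ suc m) * fromℤ j)    ≈⟨ -‿distribˡ-* _ _ ⟩
    - fromℤ (+ℤ suc m) * fromℤ j      ≈⟨ *-congʳ (fromℤ-neg (+ℤ suc m)) ⟨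
    fromℤ -[1+ m ] * fromℤ j          ∎

  almostCommutativeRing : AlmostCommutativeRing c ℓ
  almostCommutativeRing = fromCommutativeRing commutativeRing

  -- Coefficients live in ℤ because integer equality computes, so normal forms can cancel and `refl`
  -- closes the goals; equality on `Carrier` is decided only by an abstract field.
  fromℤ-morphism : ℤ.+-*-rawRing -Raw-AlmostCommutative⟶ almostCommutativeRing
  fromℤ-morphism = record
    { ⟦_⟧    = fromℤ
    ; +-homo = fromℤ-+
    ; *-homo = fromℤ-*
    ; -‿homo = fromℤ-neg
    ; 0-homo = refl
    ; 1-homo = refl
    }

  open RingSolver ℤ.+-*-rawRing almostCommutativeRing fromℤ-morphism
    (λ i j → Maybe.map (λ i≡j → reflexive (≡.cong fromℤ i≡j)) (dec⇒maybe (i ℤₚ.≟ j)))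
    public using (solve; _:=_; con; _:+_; _:*_; _:-_; :-_; Polynomial)

  -- Apart from `κ 1`, which denotes `1#`, a numeral unfolds to `fromℕ n`, the form in which
  -- constants such as `fromℕ 4` occur in goals.
  κ : ∀ {m} → ℕ → Polynomial m
  κ n = con (+ℤ n)

-- Inequalities, limits and series in the real field.

module Limits {c ℓ} (ℝ : RealField c ℓ) where

  open RealField ℝ
  open RealProperties ℝ
  open IntegerSolver ℝ
  open PartialOrderReasoning poset

  ≤-from-difference : ∀ {x y d} → 0# ≤ d → y - x ≈ d → x ≤ y
  ≤-from-difference 0≤d eq = 0≤y-x⇒x≤y (≤-respʳ-≈ (sym eq) 0≤d)

  +-nonneg : ∀ {x y} → 0# ≤ x → 0# ≤ y → 0# ≤ x + y
  +-nonneg 0≤x 0≤y = ≤-respˡ-≈ (+-identityʳ 0#) (+-mono-≤ 0≤x 0≤y)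

  *-mono-≤ : ∀ {x y u v} → 0# ≤ y → 0# ≤ u → x ≤ y → u ≤ v → x * u ≤ y * v
  *-mono-≤ 0≤y 0≤u x≤y u≤v = ≤-trans (*-monoʳ-≤ 0≤u x≤y) (*-monoˡ-≤ 0≤y u≤v)

  ²-nonneg : ∀ x → 0# ≤ x ²
  ²-nonneg x with total 0# x
  ... | inj₁ 0≤x = *-nonneg 0≤x 0≤x
  ... | inj₂ x≤0 = ≤-respʳ-≈ (solve 1 (λ x → :- x :* :- x := x :* x) refl x)
                     (*-nonneg (x≤0⇒0≤-x x≤0) (x≤0⇒0≤-x x≤0))

  ²-mono-≤ : ∀ {x y} → 0# ≤ x → x ≤ y → x ² ≤ y ²
  ²-mono-≤ 0≤x x≤y = *-mono-≤ (≤-trans 0≤x x≤y) 0≤x x≤y x≤y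

  bounded-*-mono : ∀ {x a y b} → Bounded x a → Bounded y b → Bounded (x * y) (a * b)
  bounded-*-mono {x} {a} x-bd y-bd = bounded-≤
    (*-monoʳ-≤ (bounded-nonneg y-bd) ∣x∣≤a) (bounded-* x y-bd)
    where
    ∣x∣≤a : ∣ x ∣ ≤ a
    ∣x∣≤a with total 0# x
    ... | inj₁ _ = proj₁ x-bd
    ... | inj₂ _ = proj₂ x-bd

  bounded-of-nonneg : ∀ {x b} → 0# ≤ x → x ≤ b → Bounded x b
  bounded-of-nonneg 0≤x x≤b = x≤b , ≤-trans (0≤x⇒-x≤0 0≤x) (≤-trans 0≤x x≤b)

  0≤1/1+ : ∀ n → 0# ≤ 1/1+ n
  0≤1/1+ n = proj₁ (0<1/1+ n)

  1/1+≤1 : ∀ n → 1/1+ n ≤ 1#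
  1/1+≤1 n = ≤-from-difference {d = 1/1+ n * fromℕ n} (*-nonneg (0≤1/1+ n) (0≤fromℕ n)) (begin-equality
    1# - 1/1+ n                       ≈⟨ +-congʳ (proj₂ (inverse-suc n)) ⟨
    (1# + fromℕ n) * 1/1+ n - 1/1+ n  ≈⟨ solve 2 (λ a b → (κ 1 :+ a) :* b :- b := b :* a) refl (fromℕ n) (1/1+ n) ⟩
    1/1+ n * fromℕ n                  ∎)

  -- If y < x, some n makes K / (n + 1) smaller than x - y. Arguments with an arbitrary ε thus
  -- become arguments along the sequence K / (n + 1).
  archimedean-≤ : ∀ K {x y} → (∀ n → x - y ≤ K * 1/1+ n) → x ≤ y
  archimedean-≤ K {x} {y} small with x ≤? y
  ... | yes x≤y = x≤y
  ... | no  x≰y = contradiction (small n) (<⇒≱ gap)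
    where
    0<x-y : 0# < x - y
    0<x-y = begin-strict
      0#     ≈⟨ -‿inverseʳ y ⟨
      y - y  <⟨ +-monoˡ-< (- y) (≰⇒> x≰y) ⟩
      x - y  ∎
    found = archimedean-< 0<x-y K
    n = proj₁ found
    gap : K * 1/1+ n < x - y
    gap = begin-strict
      K * 1/1+ n                          ≈⟨ *-comm _ _ ⟩
      1/1+ n * K                          <⟨ *-monoˡ-< (0<1/1+ n) (proj₂ found) ⟩
      1/1+ n * ((x - y) * fromℕ (suc n))  ≈⟨ solve 3 (λ a d m → a :* (d :* m) := (m :* a) :* d) refl _ _ _ ⟩
      fromℕ (suc n) * 1/1+ n * (x - y)    ≈⟨ *-congʳ (proj₂ (inverse-suc n)) ⟩
      1# * (x - y)                        ≈⟨ *-identityˡ _ ⟩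
      x - y                               ∎

  eventually-close : ∀ {s l} → s ConvergesTo l → ∀ k →
                     ∃[ N ] (∀ n → N ℕ.≤ n → Bounded (s n - l) (1/1+ k))
  eventually-close {s} {l} s→l k with s→l (1/1+ k) (0<1/1+ k)
  ... | N , close = N , λ n N≤n → proj₁ (proj₁ (close n N≤n)) ,
    ≤-respˡ-≈ (solve 2 (λ a b → b :- a := :- (a :- b)) refl (s n) l) (proj₁ (proj₂ (close n N≤n)))

  -- The factor `K` absorbs the constants that appear when errors are added or multiplied, so no
  -- proof has to rescale its ε.
  converges : ∀ K {s l} →
              (∀ k → ∃[ N ] (∀ n → N ℕ.≤ n → Bounded (s n - l) (K * 1/1+ k))) →
              s ConvergesTo l
  converges K {s} {l} close ε 0<ε = proj₁ (close k) , λ n N≤n →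
    below (proj₁ (proj₂ (close k) n N≤n)) ,
    below (≤-respˡ-≈ (solve 2 (λ a b → :- (a :- b) := b :- a) refl (s n) l)
                     (proj₂ (proj₂ (close k) n N≤n)))
    where
    found = archimedean-< 0<ε K
    k = proj₁ found
    below : ∀ {x} → x ≤ K * 1/1+ k → x < ε
    below {x} x≤ = begin-strict
      x                                 ≤⟨ x≤ ⟩
      K * 1/1+ k                        ≈⟨ *-comm _ _ ⟩
      1/1+ k * K                        <⟨ *-monoˡ-< (0<1/1+ k) (proj₂ found) ⟩
      1/1+ k * (ε * fromℕ (suc k))      ≈⟨ solve 3 (λ a d m → a :* (d :* m) := (m :* a) :* d) refl _ _ _ ⟩
      fromℕ (suc k) * 1/1+ k * ε        ≈⟨ *-congʳ (proj₂ (inverse-suc k)) ⟩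
      1# * ε                            ≈⟨ *-identityˡ _ ⟩
      ε                                 ∎

  converges-const : ∀ {s l} N → (∀ n → N ℕ.≤ n → s n ≈ l) → s ConvergesTo l
  converges-const {s} {l} N eq = converges 1# λ k → N , λ n N≤n →
    bounded-resp (trans (sym (-‿inverseʳ l)) (+-congʳ (sym (eq n N≤n))))
      (bounded-of-nonneg ≤-refl (*-nonneg 0≤1 (0≤1/1+ k)))

  converges-+ : ∀ {s u l m} → s ConvergesTo l → u ConvergesTo m →
                (λ n → s n + u n) ConvergesTo (l + m)
  converges-+ {s} {u} {l} {m} s→l u→m = converges (1# + 1#) λ k →
    let N , s-close = eventually-close s→l k
        M , u-close = eventually-close u→m k
    in N ℕ.⊔ M , λ n le →
      bounded-resp (solve 4 (λ a b c d → (a :- c) :+ (b :- d) := a :+ b :- (c :+ d)) refl (s n) (u n) l m)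
        (bounded-≤ (≤-reflexive (solve 1 (λ a → a :+ a := (κ 1 :+ κ 1) :* a) refl _))
          (bounded-+ (s-close n (ℕₚ.m⊔n≤o⇒m≤o N M le)) (u-close n (ℕₚ.m⊔n≤o⇒n≤o N M le))))

  converges-* : ∀ {s u l m} → s ConvergesTo l → u ConvergesTo m →
                (λ n → s n * u n) ConvergesTo (l * m)
  -- The error is s (u - m) + (s - l) m. As 1 / (k + 1) ≤ 1, the factor s is bounded by 1 + |l|,
  -- whence the constant.
  converges-* {s} {u} {l} {m} s→l u→m = converges (1# + ∣ l ∣ + ∣ m ∣) λ k →
    let N , s-close = eventually-close s→l k
        M , u-close = eventually-close u→m k
    in N ℕ.⊔ M , λ n le →
      let s-bd = s-close n (ℕₚ.m⊔n≤o⇒m≤o N M le)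
          u-bd = u-close n (ℕₚ.m⊔n≤o⇒n≤o N M le)
          s-bounded : Bounded (s n) (1# + ∣ l ∣)
          s-bounded = bounded-resp (x-y+y (s n) l)
            (bounded-+ (bounded-≤ (1/1+≤1 k) s-bd) (bounded-∣∣ l))
      in bounded-resp
          (solve 4 (λ a b c d → a :* (b :- d) :+ (a :- c) :* d := a :* b :- c :* d) refl (s n) (u n) l m)
          (bounded-≤ (≤-reflexive (solve 3 (λ a b e → a :* e :+ e :* b := (a :+ b) :* e) refl _ _ _))
            (bounded-+ (bounded-*-mono s-bounded u-bd) (bounded-*-mono s-bd (bounded-∣∣ m))))

  limit-mono-≤ : ∀ {s u l m} → s ConvergesTo l → u ConvergesTo m →
                 (∀ n → s n ≤ u n) → l ≤ m
  limit-mono-≤ {s} {u} {l} {m} s→l u→m s≤u = archimedean-≤ (1# + 1#) λ k →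
    let N , s-close = eventually-close s→l k
        M , u-close = eventually-close u→m k
        n = N ℕ.⊔ M
    in begin
      l - m                            ≈⟨ solve 4 (λ a b c d → c :- d := (:- (a :- c) :+ (b :- d)) :+ (a :- b)) refl (s n) (u n) l m ⟩
      (- (s n - l) + (u n - m)) + (s n - u n)
        ≤⟨ +-mono-≤ (+-mono-≤ (proj₂ (s-close n (ℕₚ.m≤m⊔n N M))) (proj₁ (u-close n (ℕₚ.m≤n⊔m N M))))
                    (≤-from-difference {d = u n - s n} (x≤y⇒0≤y-x (s≤u n))
                      (solve 2 (λ a b → κ 0 :- (a :- b) := b :- a) refl (s n) (u n))) ⟩
      (1/1+ k + 1/1+ k) + 0#           ≈⟨ solve 1 (λ a → (a :+ a) :+ κ 0 := (κ 1 :+ κ 1) :* a) refl _ ⟩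
      (1# + 1#) * 1/1+ k               ∎

  limit-unique : ∀ {s u l m} → s ConvergesTo l → u ConvergesTo m → (∀ n → s n ≈ u n) → l ≈ m
  limit-unique s→l u→m s≈u =
    antisym (limit-mono-≤ s→l u→m (≤-reflexive ∘ s≈u)) (limit-mono-≤ u→m s→l (≤-reflexive ∘ sym ∘ s≈u))

  converges-subsequence : ∀ {s l} (g : ℕ → ℕ) → (∀ n → n ℕ.≤ g n) →
                          s ConvergesTo l → (λ n → s (g n)) ConvergesTo l
  converges-subsequence g n≤g s→l ε 0<ε with s→l ε 0<ε
  ... | N , close = N , λ n N≤n → close (g n) (ℕₚ.≤-trans N≤n (n≤g n))

  partialSums-mono : ∀ {a} → (∀ k → 0# ≤ a k) → ∀ {m n} → m ℕ.≤ n → partialSums a m ≤ partialSums a n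
  partialSums-mono {a} 0≤a {m} {n} m≤n with ℕₚ.m≤n⇒∃[o]m+o≡n m≤n
  ... | i , ≡.refl = go i
    where
    go : ∀ i → partialSums a m ≤ partialSums a (m ℕ.+ i)
    go zero    rewrite ℕₚ.+-identityʳ m = ≤-refl
    go (suc i) rewrite ℕₚ.+-suc m i = begin
      partialSums a m                              ≤⟨ go i ⟩
      partialSums a (m ℕ.+ i)                      ≈⟨ +-identityʳ _ ⟨
      partialSums a (m ℕ.+ i) + 0#                 ≤⟨ +-monoʳ-≤ _ (0≤a (m ℕ.+ i)) ⟩
      partialSums a (m ℕ.+ i) + a (m ℕ.+ i)        ∎

  partialSums≤limit : ∀ {a l} → (∀ k → 0# ≤ a k) → partialSums a ConvergesTo l →
                      ∀ n → partialSums a n ≤ l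
  partialSums≤limit {a} {l} 0≤a a→l n = limit-mono-≤ {s = λ _ → partialSums a n} {u = λ m → partialSums a (n ℕ.+ m)}
    (converges-const 0 (λ _ _ → refl))
    (converges-subsequence (n ℕ.+_) (λ m → ℕₚ.m≤n+m m n) a→l)
    (λ m → partialSums-mono 0≤a (ℕₚ.m≤m+n n m))

  partialSums-cong : ∀ {a b} → (∀ k → a k ≈ b k) → ∀ n → partialSums a n ≈ partialSums b n
  partialSums-cong a≈b zero    = refl
  partialSums-cong a≈b (suc n) = +-cong (partialSums-cong a≈b n) (a≈b n)

-- Cauchy products of series.

module CauchyProduct {c ℓ} (ℝ : RealField c ℓ) where

  open RealField ℝ
  open RealProperties ℝ
  open IntegerSolver ℝ
  open Limits ℝ
  open PartialOrderReasoning poset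

  partialSums-shift : ∀ a n → partialSums a (suc n) ≈ a 0 + partialSums (a ∘ suc) n
  partialSums-shift a zero    = +-comm _ _
  partialSums-shift a (suc n) = trans (+-congʳ (partialSums-shift a n)) (+-assoc _ _ _)

  partialSums-nonneg : ∀ {a} → (∀ k → 0# ≤ a k) → ∀ n → 0# ≤ partialSums a n
  partialSums-nonneg 0≤a n = partialSums-mono 0≤a (ℕ.z≤n {n})

  partialSums-bounded : ∀ {a b} → (∀ k → Bounded (a k) (b k)) → ∀ {m n} → m ℕ.≤ n →
    Bounded (partialSums a n - partialSums a m) (partialSums b n - partialSums b m)
  partialSums-bounded {a} {b} a≤b {m} {n} m≤n with ℕₚ.m≤n⇒∃[o]m+o≡n m≤n
  ... | i , ≡.refl = go i
    where
    go : ∀ i → Bounded (partialSums a (m ℕ.+ i) - partialSums a m) (partialSums b (m ℕ.+ i) - partialSums b m)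
    go zero rewrite ℕₚ.+-identityʳ m = bounded-resp (sym (-‿inverseʳ _))
      (bounded-of-nonneg ≤-refl (≤-reflexive (sym (-‿inverseʳ _))))
    go (suc i) rewrite ℕₚ.+-suc m i = bounded-resp (rearrange _ _ _)
      (bounded-≤ (≤-reflexive (rearrange _ _ _)) (bounded-+ (go i) (a≤b (m ℕ.+ i))))
      where
      rearrange : ∀ x y z → x - y + z ≈ x + z - y
      rearrange = solve 3 (λ x y z → x :- y :+ z := x :+ z :- y) refl

  -- Shifting `a` while `n` decreases avoids the index n - i and its side condition i ≤ n.
  convolution : (ℕ → Carrier) → (ℕ → Carrier) → ℕ → Carrier
  convolution a b zero    = a 0 * b 0
  convolution a b (suc n) = a 0 * b (suc n) + convolution (a ∘ suc) b n

  convolution-cong : ∀ {a a′ b b′} → (∀ i → a i ≈ a′ i) → (∀ j → b j ≈ b′ j) →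
                     ∀ n → convolution a b n ≈ convolution a′ b′ n
  convolution-cong a≈ b≈ zero    = *-cong (a≈ 0) (b≈ 0)
  convolution-cong a≈ b≈ (suc n) =
    +-cong (*-cong (a≈ 0) (b≈ (suc n))) (convolution-cong (a≈ ∘ suc) b≈ n)

  convolution-suc : ∀ a b n → convolution a b (suc n) ≈ convolution a (b ∘ suc) n + a (suc n) * b 0
  convolution-suc a b zero    = refl
  convolution-suc a b (suc n) = trans (+-congˡ (convolution-suc (a ∘ suc) b n)) (sym (+-assoc _ _ _))

  convolution-scaleˡ : ∀ x a b n → convolution (λ i → x * a i) b n ≈ x * convolution a b n
  convolution-scaleˡ x a b zero    = *-assoc _ _ _
  convolution-scaleˡ x a b (suc n) =
    trans (+-cong (*-assoc _ _ _) (convolution-scaleˡ x (a ∘ suc) b n)) (sym (distribˡ _ _ _))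

  convolution-scaleʳ : ∀ x a b n → convolution a (λ j → x * b j) n ≈ x * convolution a b n
  convolution-scaleʳ x a b zero    = solve 3 (λ x a b → a :* (x :* b) := x :* (a :* b)) refl x _ _
  convolution-scaleʳ x a b (suc n) = trans (+-congˡ (convolution-scaleʳ x (a ∘ suc) b n))
    (solve 4 (λ x a b c → a :* (x :* b) :+ x :* c := x :* (a :* b :+ c)) refl x _ _ _)

  -- The Leibniz rule for the derivation (aᵢ) ↦ (i aᵢ), with general weights so
  -- that the induction can shift indices.
  convolution-leibniz : ∀ (u v : ℕ → Carrier) w a b n → (∀ i j → i ℕ.+ j ≡ n → u i + v j ≈ w) →
    convolution (λ i → u i * a i) b n + convolution a (λ j → v j * b j) n ≈ w * convolution a b n
  convolution-leibniz u v w a b zero u+v = trans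
    (solve 4 (λ u v a b → (u :* a) :* b :+ a :* (v :* b) := (u :+ v) :* (a :* b)) refl (u 0) (v 0) (a 0) (b 0))
    (*-congʳ (u+v 0 0 ≡.refl))
  convolution-leibniz u v w a b (suc n) u+v = trans
    (solve 6 (λ u v a b s t → ((u :* a) :* b :+ s) :+ (a :* (v :* b) :+ t) := (u :+ v) :* (a :* b) :+ (s :+ t))
      refl (u 0) (v (suc n)) (a 0) (b (suc n)) _ _)
    (trans (+-cong (*-congʳ (u+v 0 (suc n) ≡.refl))
      (convolution-leibniz (u ∘ suc) v w (a ∘ suc) b n (λ i j eq → u+v (suc i) j (≡.cong suc eq))))
      (sym (distribˡ _ _ _)))

  -- Σ_{i + j < n} aᵢ bⱼ
  triangle : (ℕ → Carrier) → (ℕ → Carrier) → ℕ → Carrier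
  triangle a b zero    = 0#
  triangle a b (suc n) = a 0 * partialSums b (suc n) + triangle (a ∘ suc) b n

  triangle≈partialSums : ∀ a b n → triangle a b n ≈ partialSums (convolution a b) n
  triangle≈partialSums a b zero    = refl
  triangle≈partialSums a b (suc n) = trans (step a n) (+-congʳ (triangle≈partialSums a b n))
    where
    step : ∀ a n → triangle a b (suc n) ≈ triangle a b n + convolution a b n
    step a zero    = solve 2 (λ a b → a :* (κ 0 :+ b) :+ κ 0 := κ 0 :+ a :* b) refl (a 0) (b 0)
    step a (suc n) = trans (+-congˡ (step (a ∘ suc) n))
      (solve 5 (λ a s b t c → a :* (s :+ b) :+ (t :+ c) := (a :* s :+ t) :+ (a :* b :+ c))
        refl (a 0) (partialSums b (suc n)) (b (suc n)) _ _)

  triangle≤square : ∀ {a b} → (∀ i → 0# ≤ a i) → (∀ j → 0# ≤ b j) →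
                    ∀ n → triangle a b n ≤ partialSums a n * partialSums b n
  triangle≤square 0≤a 0≤b zero    = ≤-reflexive (sym (zeroˡ _))
  triangle≤square {a} {b} 0≤a 0≤b (suc n) = begin
    a 0 * partialSums b (suc n) + triangle (a ∘ suc) b n
      ≤⟨ +-monoʳ-≤ _ (triangle≤square (0≤a ∘ suc) 0≤b n) ⟩
    a 0 * partialSums b (suc n) + partialSums (a ∘ suc) n * partialSums b n
      ≤⟨ +-monoʳ-≤ _ (*-monoˡ-≤ (partialSums-nonneg (0≤a ∘ suc) n) (partialSums-mono 0≤b (ℕₚ.n≤1+n n))) ⟩
    a 0 * partialSums b (suc n) + partialSums (a ∘ suc) n * partialSums b (suc n)
      ≈⟨ distribʳ _ _ _ ⟨
    (a 0 + partialSums (a ∘ suc) n) * partialSums b (suc n)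
      ≈⟨ *-congʳ (partialSums-shift a n) ⟨
    partialSums a (suc n) * partialSums b (suc n) ∎

  rectangle≤triangle : ∀ {a b} → (∀ i → 0# ≤ a i) → (∀ j → 0# ≤ b j) →
                       ∀ m n → partialSums a m * partialSums b n ≤ triangle a b (m ℕ.+ n)
  rectangle≤triangle {a} {b} 0≤a 0≤b zero n = begin
    0# * partialSums b n                ≈⟨ zeroˡ _ ⟩
    0#                                  ≤⟨ nonneg 0≤a n ⟩
    triangle a b n                      ∎
    where
    nonneg : ∀ {a} → (∀ i → 0# ≤ a i) → ∀ n → 0# ≤ triangle a b n
    nonneg 0≤a zero    = ≤-refl
    nonneg 0≤a (suc n) = +-nonneg (*-nonneg (0≤a 0) (partialSums-nonneg 0≤b (suc n))) (nonneg (0≤a ∘ suc) n)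
  rectangle≤triangle {a} {b} 0≤a 0≤b (suc m) n = begin
    partialSums a (suc m) * partialSums b n
      ≈⟨ *-congʳ (partialSums-shift a m) ⟩
    (a 0 + partialSums (a ∘ suc) m) * partialSums b n
      ≈⟨ distribʳ _ _ _ ⟩
    a 0 * partialSums b n + partialSums (a ∘ suc) m * partialSums b n
      ≤⟨ +-mono-≤ (*-monoˡ-≤ (0≤a 0) (partialSums-mono 0≤b (ℕₚ.m≤n+m n (suc m))))
                  (rectangle≤triangle (0≤a ∘ suc) 0≤b m n) ⟩
    a 0 * partialSums b (suc m ℕ.+ n) + triangle (a ∘ suc) b (m ℕ.+ n) ∎

  -- Since m ≤ n, the triangle lies inside the rectangle, and the difference is a sum over the pairs
  -- with i < m, j < n and i + j ≥ m. Domination of the terms therefore passes to it. This carries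
  -- the product formula from nonnegative to signed series.
  rectangle-triangle-bounded : ∀ {a a′ b b′} → (∀ i → Bounded (a i) (a′ i)) → (∀ j → Bounded (b j) (b′ j)) →
    ∀ {m n} → m ℕ.≤ n →
    Bounded (partialSums a m * partialSums b n - triangle a b m)
            (partialSums a′ m * partialSums b′ n - triangle a′ b′ m)
  rectangle-triangle-bounded {a} {a′} {b} {b′} a-bd b-bd {zero} {n} _ =
    bounded-resp (sym (vanish _)) (bounded-of-nonneg ≤-refl (≤-reflexive (sym (vanish _))))
    where
    vanish : ∀ x → 0# * x - 0# ≈ 0#
    vanish = solve 1 (λ x → κ 0 :* x :- κ 0 := κ 0) refl
  rectangle-triangle-bounded {a} {a′} {b} {b′} a-bd b-bd {suc m} {n} m<n =
    bounded-resp (split a b) (bounded-≤ (≤-reflexive (split a′ b′))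
      (bounded-+ (bounded-*-mono (a-bd 0) (partialSums-bounded b-bd m<n))
                 (rectangle-triangle-bounded (a-bd ∘ suc) b-bd (ℕₚ.≤-trans (ℕₚ.n≤1+n m) m<n))))
    where
    split : ∀ a b →
      a 0 * (partialSums b n - partialSums b (suc m)) + (partialSums (a ∘ suc) m * partialSums b n - triangle (a ∘ suc) b m)
      ≈ partialSums a (suc m) * partialSums b n - triangle a b (suc m)
    split a b = trans
      (solve 5 (λ a k l s t → a :* (k :- l) :+ (s :* k :- t) := (a :+ s) :* k :- (a :* l :+ t)) refl
        (a 0) (partialSums b n) (partialSums b (suc m)) (partialSums (a ∘ suc) m) _)
      (+-congʳ (*-congʳ (sym (partialSums-shift a m))))

-- The exponential function from its series.

-- exp is a parameter so that it is never unfolded into the completeness axiom.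
module Exponential {c ℓ} (ℝ : RealField c ℓ)
  (exp : RealField.Carrier ℝ → RealField.Carrier ℝ)
  (exp-limit : ∀ x → RealField._ConvergesTo_ ℝ (RealField.partialSums ℝ (RealProperties.expTerm ℝ x)) (exp x))
  where

  open RealField ℝ
  open RealProperties ℝ hiding (exp)
  open IntegerSolver ℝ
  open Limits ℝ
  open CauchyProduct ℝ
  open SemiringMult semiring using (×1-homo-*)
  open PartialOrderReasoning poset

  expSums : Carrier → ℕ → Carrier
  expSums x = partialSums (expTerm x)

  expTerm-cong : ∀ {x y} → x ≈ y → ∀ k → expTerm x k ≈ expTerm y k
  expTerm-cong x≈y zero    = refl
  expTerm-cong x≈y (suc k) = *-cong (expTerm-cong x≈y k) (*-congʳ x≈y)

  exp-cong : ∀ {x y} → x ≈ y → exp x ≈ exp y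
  exp-cong {x} {y} x≈y = limit-unique (exp-limit x) (exp-limit y) (partialSums-cong (expTerm-cong x≈y))

  suc*expTerm : ∀ x k → fromℕ (suc k) * expTerm x (suc k) ≈ x * expTerm x k
  suc*expTerm x k = begin-equality
    fromℕ (suc k) * (expTerm x k * (x * 1/1+ k))  ≈⟨ solve 4 (λ m t x e → m :* (t :* (x :* e)) := (m :* e) :* (x :* t)) refl _ _ _ _ ⟩
    fromℕ (suc k) * 1/1+ k * (x * expTerm x k)    ≈⟨ *-congʳ (proj₂ (inverse-suc k)) ⟩
    1# * (x * expTerm x k)                        ≈⟨ *-identityˡ _ ⟩
    x * expTerm x k                               ∎

  -- This is the binomial theorem divided by n!. Instead of binomial coefficients, the Leibniz rule
  -- with weights i and j shows that the convolution C satisfies (n + 1) C(n + 1) = (x + y) C(n),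
  -- the recurrence of the terms of `x + y`.
  expTerm-+ : ∀ x y n → convolution (expTerm x) (expTerm y) n ≈ expTerm (x + y) n
  expTerm-+ x y zero    = *-identityˡ 1#
  expTerm-+ x y (suc n) = begin-equality
    C                                      ≈⟨ *-identityˡ _ ⟨
    1# * C                                 ≈⟨ *-congʳ (proj₂ (inverse-suc n)) ⟨
    (fromℕ (suc n) * 1/1+ n) * C           ≈⟨ solve 3 (λ m e c → (m :* e) :* c := (m :* c) :* e) refl _ _ _ ⟩
    (fromℕ (suc n) * C) * 1/1+ n           ≈⟨ *-congʳ recurrence ⟩
    ((x + y) * expTerm (x + y) n) * 1/1+ n ≈⟨ solve 3 (λ z t e → (z :* t) :* e := t :* (z :* e)) refl _ _ _ ⟩
    expTerm (x + y) (suc n)                ∎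
    where
    C = convolution (expTerm x) (expTerm y) (suc n)
    left : convolution (λ i → fromℕ i * expTerm x i) (expTerm y) (suc n) ≈ x * expTerm (x + y) n
    left = begin-equality
      (0# * expTerm x 0) * expTerm y (suc n) + convolution (λ i → fromℕ (suc i) * expTerm x (suc i)) (expTerm y) n
        ≈⟨ solve 3 (λ s t u → (κ 0 :* s) :* t :+ u := u) refl _ _ _ ⟩
      convolution (λ i → fromℕ (suc i) * expTerm x (suc i)) (expTerm y) n
        ≈⟨ convolution-cong (suc*expTerm x) (λ _ → refl) n ⟩
      convolution (λ i → x * expTerm x i) (expTerm y) n
        ≈⟨ convolution-scaleˡ x _ _ n ⟩
      x * convolution (expTerm x) (expTerm y) n
        ≈⟨ *-congˡ (expTerm-+ x y n) ⟩
      x * expTerm (x + y) n ∎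
    right : convolution (expTerm x) (λ j → fromℕ j * expTerm y j) (suc n) ≈ y * expTerm (x + y) n
    right = begin-equality
      convolution (expTerm x) (λ j → fromℕ j * expTerm y j) (suc n)
        ≈⟨ convolution-suc (expTerm x) (λ j → fromℕ j * expTerm y j) n ⟩
      convolution (expTerm x) (λ j → fromℕ (suc j) * expTerm y (suc j)) n + expTerm x (suc n) * (0# * 1#)
        ≈⟨ solve 3 (λ s t u → u :+ s :* (κ 0 :* t) := u) refl _ _ _ ⟩
      convolution (expTerm x) (λ j → fromℕ (suc j) * expTerm y (suc j)) n
        ≈⟨ convolution-cong (λ _ → refl) (suc*expTerm y) n ⟩
      convolution (expTerm x) (λ j → y * expTerm y j) n
        ≈⟨ convolution-scaleʳ y _ _ n ⟩
      y * convolution (expTerm x) (expTerm y) n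
        ≈⟨ *-congˡ (expTerm-+ x y n) ⟩
      y * expTerm (x + y) n ∎
    recurrence : fromℕ (suc n) * C ≈ (x + y) * expTerm (x + y) n
    recurrence = begin-equality
      fromℕ (suc n) * C
        ≈⟨ convolution-leibniz fromℕ fromℕ (fromℕ (suc n)) (expTerm x) (expTerm y) (suc n)
             (λ i j eq → trans (sym (fromℕ-+ i j)) (reflexive (≡.cong fromℕ eq))) ⟨
      _ ≈⟨ +-cong left right ⟩
      x * expTerm (x + y) n + y * expTerm (x + y) n  ≈⟨ distribʳ _ _ _ ⟨
      (x + y) * expTerm (x + y) n ∎

  triangle-expTerm : ∀ x y n → triangle (expTerm x) (expTerm y) n ≈ expSums (x + y) n
  triangle-expTerm x y n = trans (triangle≈partialSums _ _ n) (partialSums-cong (expTerm-+ x y) n)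

  expTerm-bounded : ∀ {x b} → Bounded x b → ∀ k → Bounded (expTerm x k) (expTerm b k)
  expTerm-bounded x-bd zero    = bounded-of-nonneg 0≤1 ≤-refl
  expTerm-bounded x-bd (suc k) = bounded-*-mono (expTerm-bounded x-bd k)
    (bounded-*-mono x-bd (bounded-of-nonneg (0≤1/1+ k) ≤-refl))

  expTerm-nonneg : ∀ {x} → 0# ≤ x → ∀ k → 0# ≤ expTerm x k
  expTerm-nonneg 0≤x k = bounded-nonneg (expTerm-bounded (bounded-of-nonneg 0≤x ≤-refl) k)

  -- With nonnegative terms, the triangle of size n lies below the square of size n, which lies
  -- below the triangle of size 2n. The outer two tend to `exp (x + y)`.
  exp-+-nonneg : ∀ {x y} → 0# ≤ x → 0# ≤ y → exp x * exp y ≈ exp (x + y)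
  exp-+-nonneg {x} {y} 0≤x 0≤y = antisym
    (limit-mono-≤ (converges-* (exp-limit x) (exp-limit y))
      (converges-subsequence (λ n → n ℕ.+ n) (λ n → ℕₚ.m≤m+n n n) (exp-limit (x + y)))
      (λ n → ≤-respʳ-≈ (triangle-expTerm x y (n ℕ.+ n)) (rectangle≤triangle (expTerm-nonneg 0≤x) (expTerm-nonneg 0≤y) n n)))
    (limit-mono-≤ (exp-limit (x + y)) (converges-* (exp-limit x) (exp-limit y))
      (λ n → ≤-respˡ-≈ (triangle-expTerm x y n) (triangle≤square (expTerm-nonneg 0≤x) (expTerm-nonneg 0≤y) n)))

  -- The gap between the square and the triangle for x, y is dominated by the gap for |x|, |y|, and
  -- the latter tends to 0 by the nonnegative case.
  exp-+ : ∀ x y → exp (x + y) ≈ exp x * exp y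
  exp-+ x y = sym (antisym
    (+-cancelˡ-≤ (exp (X + Y)) (begin
      exp (X + Y) + exp x * exp y  ≤⟨ limit-mono-≤
        (converges-+ (exp-limit (X + Y)) (converges-* (exp-limit x) (exp-limit y)))
        (converges-+ (converges-* (exp-limit X) (exp-limit Y)) (exp-limit (x + y)))
        (λ n → swap (proj₁ (error n))) ⟩
      exp X * exp Y + exp (x + y)  ≈⟨ +-congʳ abs-case ⟩
      exp (X + Y) + exp (x + y)    ∎))
    (+-cancelˡ-≤ (exp (X + Y)) (begin
      exp (X + Y) + exp (x + y)    ≤⟨ limit-mono-≤
        (converges-+ (exp-limit (X + Y)) (exp-limit (x + y)))
        (converges-+ (converges-* (exp-limit X) (exp-limit Y)) (converges-* (exp-limit x) (exp-limit y)))
        (λ n → swap (≤-respˡ-≈ (solve 2 (λ u v → :- (u :- v) := v :- u) refl _ _) (proj₂ (error n)))) ⟩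
      exp X * exp Y + exp x * exp y ≈⟨ +-congʳ abs-case ⟩
      exp (X + Y) + exp x * exp y  ∎)))
    where
    X = ∣ x ∣
    Y = ∣ y ∣
    abs-case : exp X * exp Y ≈ exp (X + Y)
    abs-case = exp-+-nonneg (0≤∣∣ x) (0≤∣∣ y)
    -- Clears the subtractions, so that only sums and products pass to the limit.
    swap : ∀ {u v p q} → u - v ≤ p - q → q + u ≤ p + v
    swap {u} {v} {p} {q} le = ≤-from-difference (x≤y⇒0≤y-x le)
      (solve 4 (λ u v p q → (p :+ v) :- (q :+ u) := (p :- q) :- (u :- v)) refl u v p q)
    error : ∀ n → Bounded (expSums x n * expSums y n - expSums (x + y) n)
                          (expSums X n * expSums Y n - expSums (X + Y) n)
    error n = bounded-resp (+-congˡ (-‿cong (triangle-expTerm x y n)))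
      (bounded-≤ (≤-reflexive (+-congˡ (-‿cong (triangle-expTerm X Y n))))
        (rectangle-triangle-bounded (expTerm-bounded (bounded-∣∣ x)) (expTerm-bounded (bounded-∣∣ y)) (ℕₚ.≤-refl {n})))

  exp-0 : exp 0# ≈ 1#
  exp-0 = limit-unique (exp-limit 0#) (converges-const {expSums 0#} 1 sums) (λ _ → refl)
    where
    sums : ∀ n → 1 ℕ.≤ n → expSums 0# n ≈ 1#
    sums (suc zero)    _ = +-identityˡ 1#
    sums (suc (suc n)) _ = trans
      (+-cong (sums (suc n) (ℕ.s≤s ℕ.z≤n)) (solve 2 (λ t e → t :* (κ 0 :* e) := κ 0) refl _ _)) (+-identityʳ 1#)

  1/1≈1 : 1/1+ 0 ≈ 1#
  1/1≈1 = trans (solve 1 (λ e → e := (κ 1 :+ κ 0) :* e) refl _) (proj₂ (inverse-suc 0))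

  expSums-2 : ∀ x → expSums x 2 ≈ 1# + x
  expSums-2 x = begin-equality
    (0# + 1#) + 1# * (x * 1/1+ 0)  ≈⟨ +-congˡ (*-congˡ (*-congˡ 1/1≈1)) ⟩
    (0# + 1#) + 1# * (x * 1#)      ≈⟨ solve 1 (λ x → (κ 0 :+ κ 1) :+ κ 1 :* (x :* κ 1) := κ 1 :+ x) refl x ⟩
    1# + x                         ∎

  1+x≤exp : ∀ {x} → 0# ≤ x → 1# + x ≤ exp x
  1+x≤exp {x} 0≤x = ≤-respˡ-≈ (expSums-2 x) (partialSums≤limit (expTerm-nonneg 0≤x) (exp-limit x) 2)

  1≤exp : ∀ {x} → 0# ≤ x → 1# ≤ exp x
  1≤exp {x} 0≤x = begin
    1#       ≈⟨ +-identityʳ 1# ⟨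
    1# + 0#  ≤⟨ +-monoʳ-≤ 1# 0≤x ⟩
    1# + x   ≤⟨ 1+x≤exp 0≤x ⟩
    exp x    ∎

  exp-inverse : ∀ x → exp (- x) * exp x ≈ 1#
  exp-inverse x = trans (sym (exp-+ (- x) x)) (trans (exp-cong (-‿inverseˡ x)) exp-0)

  exp-nonneg : ∀ x → 0# ≤ exp x
  exp-nonneg x with total 0# x
  ... | inj₁ 0≤x = ≤-trans 0≤1 (1≤exp 0≤x)
  -- The terms now alternate in sign, so positivity comes from `exp (- x) * exp x ≈ 1#` instead of
  -- the series.
  ... | inj₂ x≤0 = proj₁ (inverse-pos (begin-strict
    0#         <⟨ 0<1 ⟩
    1#         ≤⟨ 1≤exp (x≤0⇒0≤-x x≤0) ⟩
    exp (- x)  ∎) (exp-inverse x))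

  exp-mono : ∀ {x y} → x ≤ y → exp x ≤ exp y
  exp-mono {x} {y} x≤y = begin
    exp x                  ≈⟨ *-identityʳ _ ⟨
    exp x * 1#             ≤⟨ *-monoˡ-≤ (exp-nonneg x) (1≤exp (x≤y⇒0≤y-x x≤y)) ⟩
    exp x * exp (y - x)    ≈⟨ exp-+ x (y - x) ⟨
    exp (x + (y - x))      ≈⟨ exp-cong (solve 2 (λ x y → x :+ (y :- x) := y) refl x y) ⟩
    exp y                  ∎

  -- A substitute for Taylor's theorem: beyond the first two terms, x² factors out and what remains
  -- of each term is at most b^k / k!. The linear term stays exact, which the later cancellation
  -- requires.
  exp-quadratic-bound : ∀ {x b} → Bounded x b → exp x ≤ 1# + x + x ² * exp b
  exp-quadratic-bound {x} {b} x-bd = limit-mono-≤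
    (converges-subsequence (2 ℕ.+_) (ℕₚ.m≤n+m _ ∘ λ _ → 2) (exp-limit x))
    (converges-+ (converges-const 0 (λ _ _ → refl)) (converges-* (converges-const 0 (λ _ _ → refl)) (exp-limit b)))
    sums
    where
    term : ∀ k → expTerm x (2 ℕ.+ k) ≤ x ² * expTerm b k
    term k = begin
      expTerm x k * (x * 1/1+ k) * (x * 1/1+ (suc k))
        ≈⟨ solve 4 (λ t x e f → t :* (x :* e) :* (x :* f) := x :* x :* (t :* (e :* f))) refl _ _ _ _ ⟩
      x ² * (expTerm x k * (1/1+ k * 1/1+ (suc k)))
        ≤⟨ *-monoˡ-≤ (²-nonneg x) (proj₁ (bounded-*-mono (expTerm-bounded x-bd k)
             (bounded-of-nonneg (*-nonneg (0≤1/1+ k) (0≤1/1+ (suc k)))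
               (*-mono-≤ 0≤1 (0≤1/1+ (suc k)) (1/1+≤1 k) (1/1+≤1 (suc k)))))) ⟩
      x ² * (expTerm b k * (1# * 1#))
        ≈⟨ solve 2 (λ x t → x :* (t :* (κ 1 :* κ 1)) := x :* t) refl _ _ ⟩
      x ² * expTerm b k ∎
    sums : ∀ n → expSums x (2 ℕ.+ n) ≤ 1# + x + x ² * expSums b n
    sums zero = ≤-reflexive (trans (expSums-2 x) (solve 2 (λ y z → y := y :+ z :* κ 0) refl _ _))
    sums (suc n) = begin
      expSums x (2 ℕ.+ n) + expTerm x (2 ℕ.+ n)
        ≤⟨ +-mono-≤ (sums n) (term n) ⟩
      1# + x + x ² * expSums b n + x ² * expTerm b n
        ≈⟨ solve 4 (λ y z s t → y :+ z :* s :+ z :* t := y :+ z :* (s :+ t)) refl _ _ _ _ ⟩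
      1# + x + x ² * (expSums b n + expTerm b n) ∎

  -- The even index is written `n * 2` because it unfolds at `suc n` to two successors, so both
  -- `expTerm` and the partial sums advance by two.
  expTerm-even-neg : ∀ x n → expTerm (- x) (n ℕ.* 2) ≈ expTerm x (n ℕ.* 2)
  expTerm-even-neg x zero    = refl
  expTerm-even-neg x (suc n) = trans (*-congʳ (*-congʳ (expTerm-even-neg x n)))
    (solve 4 (λ t x e f → t :* (:- x :* e) :* (:- x :* f) := t :* (x :* e) :* (x :* f)) refl _ _ _ _)

  2/[2+2n]≈1/[1+n] : ∀ n → fromℕ 2 * 1/1+ (suc (n ℕ.* 2)) ≈ 1/1+ n
  2/[2+2n]≈1/[1+n] n = begin-equality
    fromℕ 2 * f                            ≈⟨ *-identityˡ _ ⟨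
    1# * (fromℕ 2 * f)                     ≈⟨ *-congʳ (proj₂ (inverse-suc n)) ⟨
    fromℕ (suc n) * 1/1+ n * (fromℕ 2 * f) ≈⟨ solve 4 (λ m e t f → m :* e :* (t :* f) := (m :* t) :* f :* e) refl _ _ _ _ ⟩
    (fromℕ (suc n) * fromℕ 2) * f * 1/1+ n ≈⟨ *-congʳ (*-congʳ (×1-homo-* (suc n) 2)) ⟨
    fromℕ (suc n ℕ.* 2) * f * 1/1+ n       ≈⟨ *-congʳ (proj₂ (inverse-suc (suc (n ℕ.* 2)))) ⟩
    1# * 1/1+ n                            ≈⟨ *-identityˡ _ ⟩
    1/1+ n                                 ∎
    where f = 1/1+ (suc (n ℕ.* 2))

  -- From n to n + 1 the left side gains (2y)² / ((2n + 1)(2n + 2)), which is 1 / (2n + 1) times the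
  -- factor 2y² / (n + 1) gained on the right.
  expTerm-even-bound : ∀ y n → Bounded (expTerm (fromℕ 2 * y) (n ℕ.* 2)) (expTerm (fromℕ 2 * y ²) n)
  expTerm-even-bound y zero    = bounded-of-nonneg 0≤1 ≤-refl
  expTerm-even-bound y (suc n) = bounded-resp
    (solve 5 (λ w t y e f → t :* (e :* (w :* (y :* y) :* (w :* f))) := t :* (w :* y :* e) :* (w :* y :* f)) refl
      (fromℕ 2) (expTerm (fromℕ 2 * y) (n ℕ.* 2)) y (1/1+ (n ℕ.* 2)) (1/1+ (suc (n ℕ.* 2))))
    (bounded-*-mono (expTerm-even-bound y n) (bounded-of-nonneg
      (*-nonneg (0≤1/1+ (n ℕ.* 2)) (≤-respʳ-≈ (*-congˡ (sym (2/[2+2n]≈1/[1+n] n))) 0≤z))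
      (begin
        1/1+ (n ℕ.* 2) * (fromℕ 2 * y ² * (fromℕ 2 * 1/1+ (suc (n ℕ.* 2))))  ≈⟨ *-congˡ (*-congˡ (2/[2+2n]≈1/[1+n] n)) ⟩
        1/1+ (n ℕ.* 2) * (fromℕ 2 * y ² * 1/1+ n)                            ≤⟨ *-monoʳ-≤ 0≤z (1/1+≤1 (n ℕ.* 2)) ⟩
        1# * (fromℕ 2 * y ² * 1/1+ n)                                        ≈⟨ *-identityˡ _ ⟩
        fromℕ 2 * y ² * 1/1+ n                                               ∎)))
    where
    0≤z : 0# ≤ fromℕ 2 * y ² * 1/1+ n
    0≤z = *-nonneg (*-nonneg (0≤fromℕ 2) (²-nonneg y)) (0≤1/1+ n)

  cosh-bound : ∀ y → exp (fromℕ 2 * y) + exp (- (fromℕ 2 * y)) ≤ fromℕ 2 * exp (fromℕ 2 * y ²)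
  cosh-bound y = limit-mono-≤
    (converges-+ (converges-subsequence (ℕ._* 2) (λ n → ℕₚ.m≤m*n n 2) (exp-limit x))
                 (converges-subsequence (ℕ._* 2) (λ n → ℕₚ.m≤m*n n 2) (exp-limit (- x))))
    (converges-* (converges-const 0 (λ _ _ → refl)) (exp-limit z))
    sums
    where
    x = fromℕ 2 * y
    z = fromℕ 2 * y ²
    sums : ∀ n → expSums x (n ℕ.* 2) + expSums (- x) (n ℕ.* 2) ≤ fromℕ 2 * expSums z n
    sums zero    = ≤-reflexive (solve 0 (κ 0 :+ κ 0 := κ 2 :* κ 0) refl)
    sums (suc n) = begin
      (expSums x m + expTerm x m + expTerm x m * (x * 1/1+ m)) +
      (expSums (- x) m + expTerm (- x) m + expTerm (- x) m * (- x * 1/1+ m))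
        ≈⟨ +-congˡ (+-cong (+-congˡ (expTerm-even-neg x n)) (*-congʳ (expTerm-even-neg x n))) ⟩
      (expSums x m + expTerm x m + expTerm x m * (x * 1/1+ m)) +
      (expSums (- x) m + expTerm x m + expTerm x m * (- x * 1/1+ m))
        -- The odd terms cancel and the even ones double, so each block of two terms is matched with
        -- one term of the series for `z`.
        ≈⟨ solve 5 (λ s s′ t x e → (s :+ t :+ t :* (x :* e)) :+ (s′ :+ t :+ t :* (:- x :* e))
                                    := (s :+ s′) :+ κ 2 :* t) refl _ _ _ _ _ ⟩
      (expSums x m + expSums (- x) m) + fromℕ 2 * expTerm x m
        ≤⟨ +-mono-≤ (sums n) (*-monoˡ-≤ (0≤fromℕ 2) (proj₁ (expTerm-even-bound y n))) ⟩
      fromℕ 2 * expSums z n + fromℕ 2 * expTerm z n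
        ≈⟨ distribˡ _ _ _ ⟨
      fromℕ 2 * (expSums z n + expTerm z n) ∎
      where m = n ℕ.* 2

-- Hoeffding's lemma for a Bernoulli variable.

module HoeffdingLemma {c ℓ} (ℝ : RealField c ℓ)
  (exp : RealField.Carrier ℝ → RealField.Carrier ℝ)
  (exp-limit : ∀ x → RealField._ConvergesTo_ ℝ (RealField.partialSums ℝ (RealProperties.expTerm ℝ x)) (exp x))
  where

  open RealField ℝ
  open RealProperties ℝ hiding (exp)
  open IntegerSolver ℝ
  open Limits ℝ
  open Exponential ℝ exp exp-limit
  open PartialOrderReasoning poset

  -- With q = 1 - p, m = p v + q u and δ = p v - q u, one has m² = δ² + 4pq uv and p v² + q u² = δ²
  -- + pq (u + v)². The gap is then visibly a sum of nonnegative terms.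
  weighted-squares-bound : ∀ {p u v w} → 0# ≤ p → p ≤ 1# → 1# ≤ w →
    (u + v) ² ≤ fromℕ 4 * (u * v) * w →
    p * v ² + (1# - p) * u ² ≤ (p * v + (1# - p) * u) ² * w
  weighted-squares-bound {p} {u} {v} {w} 0≤p p≤1 1≤w sum≤ = ≤-from-difference
    (+-nonneg (*-nonneg (²-nonneg (p * v - (1# - p) * u)) (x≤y⇒0≤y-x 1≤w))
              (*-nonneg (*-nonneg 0≤p (x≤y⇒0≤y-x p≤1)) (x≤y⇒0≤y-x sum≤)))
    (solve 4 (λ p u v w →
        let q = κ 1 :- p
            m = p :* v :+ q :* u
            δ = p :* v :- q :* u
        in m :* m :* w :- (p :* (v :* v) :+ q :* (u :* u))
           := δ :* δ :* (w :- κ 1) :+ p :* q :* (κ 4 :* (u :* v) :* w :- (u :+ v) :* (u :+ v)))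
      refl p u v w)

  half : Carrier
  half = 1/1+ 1

  -- Repeated halving would give 2⁻ᵏ; weakening this to 1 / (k + 1) is enough for `archimedean-≤`
  -- and keeps the induction in terms of `1/1+`.
  half*1/1+≤ : ∀ k → half * 1/1+ k ≤ 1/1+ (suc k)
  half*1/1+≤ k = ≤-from-difference
    (*-nonneg (*-nonneg (0≤1/1+ 1) (0≤1/1+ k)) (*-nonneg (0≤fromℕ k) (0≤1/1+ (suc k))))
    (begin-equality
      e′ - half * e
        ≈⟨ solve 3 (λ h e e′ → e′ :- h :* e := e′ :* (κ 1 :* κ 1) :- h :* e :* κ 1) refl half e e′ ⟩
      e′ * (1# * 1#) - half * e * 1#
        ≈⟨ +-cong (*-congˡ (*-cong (proj₂ (inverse-suc 1)) (proj₂ (inverse-suc k)))) (-‿cong (*-congˡ (proj₂ (inverse-suc (suc k))))) ⟨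
      e′ * ((fromℕ 2 * half) * ((1# + fromℕ k) * e)) - half * e * ((1# + (1# + fromℕ k)) * e′)
        ≈⟨ solve 4 (λ h e e′ k → e′ :* ((κ 2 :* h) :* ((κ 1 :+ k) :* e)) :- h :* e :* ((κ 1 :+ (κ 1 :+ k)) :* e′)
             := h :* e :* (k :* e′)) refl half e e′ (fromℕ k) ⟩
      half * e * (fromℕ k * e′) ∎)
    where
    e  = 1/1+ k
    e′ = 1/1+ (suc k)

  -- The moment generating function of X - p at 4 y, where X ∼ b(p).
  mgf : Carrier → Carrier → Carrier
  mgf p y = p * exp (fromℕ 4 * (1# - p) * y) + (1# - p) * exp (- (fromℕ 4 * p * y))

  module _ {p} (0≤p : 0# ≤ p) (p≤1 : p ≤ 1#) where

    private
      q = 1# - p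

      0≤q : 0# ≤ q
      0≤q = x≤y⇒0≤y-x p≤1

      q≤1 : q ≤ 1#
      q≤1 = ≤-from-difference 0≤p (solve 1 (λ p → κ 1 :- (κ 1 :- p) := p) refl p)

    mgf-cong : ∀ {x y} → x ≈ y → mgf p x ≈ mgf p y
    mgf-cong x≈y = +-cong (*-congˡ (exp-cong (*-congˡ x≈y))) (*-congˡ (exp-cong (-‿cong (*-congˡ x≈y))))

    mgf-nonneg : ∀ y → 0# ≤ mgf p y
    mgf-nonneg y = +-nonneg (*-nonneg 0≤p (exp-nonneg _)) (*-nonneg 0≤q (exp-nonneg _))

    -- A multiplicative form of (log ∘ mgf p)″ ≤ 4, using mgf p 0 = 1.
    mgf-doubling : ∀ y → mgf p (fromℕ 2 * y) ≤ mgf p y ² * exp (fromℕ 4 * y ²)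
    mgf-doubling y = begin
      mgf p (fromℕ 2 * y)
        ≈⟨ +-cong (*-congˡ (exp-double (solve 2 (λ p y → κ 4 :* (κ 1 :- p) :* (κ 2 :* y)
                                := κ 4 :* (κ 1 :- p) :* y :+ κ 4 :* (κ 1 :- p) :* y) refl p y)))
                  (*-congˡ (exp-double (solve 2 (λ p y → :- (κ 4 :* p :* (κ 2 :* y))
                                := :- (κ 4 :* p :* y) :+ :- (κ 4 :* p :* y)) refl p y))) ⟩
      p * v ² + q * u ²
        ≤⟨ weighted-squares-bound 0≤p p≤1 (1≤exp (*-nonneg (0≤fromℕ 4) (²-nonneg y))) sum≤ ⟩
      mgf p y ² * w ∎
      where
      exp-double : ∀ {x z} → z ≈ x + x → exp z ≈ exp x ²
      exp-double eq = trans (exp-cong eq) (exp-+ _ _)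
      v = exp (fromℕ 4 * q * y)
      u = exp (- (fromℕ 4 * p * y))
      w = exp (fromℕ 4 * y ²)
      -- The geometric mean of `u` and `v`. Dividing by it leaves `exp (- x)` and `exp x`, the shape
      -- of `cosh-bound`.
      m = exp (fromℕ 2 * (q - p) * y)
      x = fromℕ 2 * y
      v≈ : v ≈ m * exp x
      v≈ = trans (exp-cong (solve 2 (λ p y → κ 4 :* (κ 1 :- p) :* y := κ 2 :* (κ 1 :- p :- p) :* y :+ κ 2 :* y) refl p y)) (exp-+ _ _)
      u≈ : u ≈ m * exp (- x)
      u≈ = trans (exp-cong (solve 2 (λ p y → :- (κ 4 :* p :* y) := κ 2 :* (κ 1 :- p :- p) :* y :+ :- (κ 2 :* y)) refl p y)) (exp-+ _ _)
      uv≈ : u * v ≈ m ²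
      uv≈ = begin-equality
        u * v                            ≈⟨ *-cong u≈ v≈ ⟩
        (m * exp (- x)) * (m * exp x)    ≈⟨ solve 3 (λ m a b → (m :* a) :* (m :* b) := m :* m :* (a :* b)) refl m _ _ ⟩
        m ² * (exp (- x) * exp x)        ≈⟨ *-congˡ (exp-inverse x) ⟩
        m ² * 1#                         ≈⟨ *-identityʳ _ ⟩
        m ²                              ∎
      sum≤ : (u + v) ² ≤ fromℕ 4 * (u * v) * w
      sum≤ = begin
        (u + v) ²
          ≈⟨ *-cong (+-cong u≈ v≈) (+-cong u≈ v≈) ⟩
        (m * exp (- x) + m * exp x) ²
          ≈⟨ solve 3 (λ m a b → (m :* a :+ m :* b) :* (m :* a :+ m :* b) := m :* m :* ((b :+ a) :* (b :+ a))) refl m _ _ ⟩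
        m ² * (exp x + exp (- x)) ²
          ≤⟨ *-monoˡ-≤ (²-nonneg m) (²-mono-≤ (+-nonneg (exp-nonneg x) (exp-nonneg (- x))) (cosh-bound y)) ⟩
        m ² * (fromℕ 2 * exp (fromℕ 2 * y ²)) ²
          ≈⟨ solve 2 (λ m a → m :* m :* ((κ 2 :* a) :* (κ 2 :* a)) := κ 4 :* (m :* m) :* (a :* a)) refl m _ ⟩
        fromℕ 4 * m ² * exp (fromℕ 2 * y ²) ²
          ≈⟨ *-cong (*-congˡ uv≈) (exp-double (solve 1 (λ y → κ 4 :* (y :* y) := κ 2 :* (y :* y) :+ κ 2 :* (y :* y)) refl y)) ⟨
        fromℕ 4 * (u * v) * w ∎

    -- For |y| ≤ 1 both exponents of `mgf` are at most 4 in absolute value, so the quadratic bound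
    -- applies with b = 4, written in the form that `bounded-*-mono` produces. The factor is p (4q)²
    -- + q (4p)² = 16pq. All that matters is that it does not depend on y.
    curvature : Carrier
    curvature = fromℕ 16 * (p * q) * exp (fromℕ 4 * 1# * 1#)

    0≤curvature : 0# ≤ curvature
    0≤curvature = *-nonneg (*-nonneg (0≤fromℕ 16) (*-nonneg 0≤p 0≤q)) (exp-nonneg _)

    mgf-quadratic-bound : ∀ {y} → Bounded y 1# → mgf p y ≤ exp (curvature * y ²)
    mgf-quadratic-bound {y} y-bd = begin
      mgf p y
        ≤⟨ +-mono-≤ (*-monoˡ-≤ 0≤p (exp-quadratic-bound (scaled 0≤q q≤1)))
                    (*-monoˡ-≤ 0≤q (exp-quadratic-bound (bounded-neg (scaled 0≤p p≤1)))) ⟩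
      p * (1# + a + a ² * e) + q * (1# + - b + (- b) ² * e)
        ≈⟨ solve 3 (λ p y e →
             let q = κ 1 :- p
                 a = κ 4 :* q :* y
                 b = κ 4 :* p :* y
             in p :* (κ 1 :+ a :+ a :* a :* e) :+ q :* (κ 1 :+ :- b :+ (:- b) :* (:- b) :* e)
                := κ 1 :+ κ 16 :* (p :* q) :* e :* (y :* y)) refl p y e ⟩
      1# + curvature * y ²
        ≤⟨ 1+x≤exp (*-nonneg 0≤curvature (²-nonneg y)) ⟩
      exp (curvature * y ²) ∎
      where
      a = fromℕ 4 * q * y
      b = fromℕ 4 * p * y
      e = exp (fromℕ 4 * 1# * 1#)
      scaled : ∀ {z} → 0# ≤ z → z ≤ 1# → Bounded (fromℕ 4 * z * y) (fromℕ 4 * 1# * 1#)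
      scaled 0≤z z≤1 = bounded-*-mono
        (bounded-*-mono (bounded-of-nonneg (0≤fromℕ 4) ≤-refl) (bounded-of-nonneg 0≤z z≤1)) y-bd

    -- Passing from half y to y turns the excess exponent c y² into at most (c / 2) y².
    mgf-bound-with-excess : ∀ k {y} → Bounded y 1# → mgf p y ≤ exp ((fromℕ 2 + curvature * 1/1+ k) * y ²)
    mgf-bound-with-excess zero    {y} y-bd = begin
      mgf p y                                   ≤⟨ mgf-quadratic-bound y-bd ⟩
      exp (curvature * y ²)                     ≤⟨ exp-mono (*-monoʳ-≤ (²-nonneg y) (≤-from-difference (0≤fromℕ 2)
                                                    (trans (+-congʳ (+-congˡ (*-congˡ 1/1≈1)))
                                                      (solve 1 (λ c → κ 2 :+ c :* κ 1 :- c := κ 2) refl curvature)))) ⟩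
      exp ((fromℕ 2 + curvature * 1/1+ 0) * y ²) ∎
    mgf-bound-with-excess (suc k) {y} y-bd = begin
      mgf p y                              ≈⟨ mgf-cong y≈2h ⟩
      mgf p (fromℕ 2 * h)                  ≤⟨ mgf-doubling h ⟩
      mgf p h ² * exp (fromℕ 4 * h ²)      ≤⟨ *-monoʳ-≤ (exp-nonneg _) (²-mono-≤ (mgf-nonneg h) (mgf-bound-with-excess k h-bd)) ⟩
      exp (s * h ²) ² * exp (fromℕ 4 * h ²)  ≈⟨ *-congʳ (exp-+ _ _) ⟨
      exp (s * h ² + s * h ²) * exp (fromℕ 4 * h ²)  ≈⟨ exp-+ _ _ ⟨
      exp (s * h ² + s * h ² + fromℕ 4 * h ²)
        ≈⟨ exp-cong (solve 3 (λ c e h → let s = κ 2 :+ c :* e in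
             s :* (h :* h) :+ s :* (h :* h) :+ κ 4 :* (h :* h)
             := (κ 8 :+ κ 2 :* c :* e) :* (h :* h)) refl curvature (1/1+ k) h) ⟩
      exp ((fromℕ 8 + fromℕ 2 * curvature * 1/1+ k) * h ²)
        -- Inserting `2 * half = 1` allows h² to be regrouped as (2h)²: then 8h² is 2y², and the
        -- excess shows its factor `half`.
        ≈⟨ exp-cong (*-congʳ (+-congˡ (trans (solve 1 (λ x → x := κ 1 :* x) refl _) (*-congʳ (sym (proj₂ (inverse-suc 1))))))) ⟩
      exp ((fromℕ 8 + fromℕ 2 * half * (fromℕ 2 * curvature * 1/1+ k)) * h ²)
        ≈⟨ exp-cong (solve 4 (λ c e h g → (κ 8 :+ κ 2 :* g :* (κ 2 :* c :* e)) :* (h :* h)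
             := (κ 2 :+ c :* (g :* e)) :* (κ 2 :* h :* (κ 2 :* h))) refl curvature (1/1+ k) h half) ⟩
      exp ((fromℕ 2 + curvature * (half * 1/1+ k)) * (fromℕ 2 * h) ²)
        ≈⟨ exp-cong (*-congˡ (*-cong y≈2h y≈2h)) ⟨
      exp ((fromℕ 2 + curvature * (half * 1/1+ k)) * y ²)
        ≤⟨ exp-mono (*-monoʳ-≤ (²-nonneg y) (+-monoʳ-≤ _ (*-monoˡ-≤ 0≤curvature (half*1/1+≤ k)))) ⟩
      exp ((fromℕ 2 + curvature * 1/1+ (suc k)) * y ²) ∎
      where
      h = half * y
      s = fromℕ 2 + curvature * 1/1+ k
      y≈2h : y ≈ fromℕ 2 * h
      y≈2h = trans (sym (*-identityˡ y)) (trans (*-congʳ (sym (proj₂ (inverse-suc 1)))) (*-assoc _ _ _))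
      h-bd : Bounded h 1#
      h-bd = bounded-≤ (≤-reflexive (*-identityˡ 1#))
        (bounded-*-mono (bounded-of-nonneg (0≤1/1+ 1) (1/1+≤1 1)) y-bd)

    -- Letting k grow removes the excess. With E the claimed bound and z = `curvature * y ²`, the
    -- error is E (exp (z / (k + 1)) - 1), and `exp-quadratic-bound` makes it at most a fixed
    -- multiple of 1 / (k + 1).
    mgf-bound : ∀ {y} → Bounded y 1# → mgf p y ≤ exp (fromℕ 2 * y ²)
    mgf-bound {y} y-bd = archimedean-≤ (E * (z + z ² * exp z)) λ k → begin
      mgf p y - E
        ≤⟨ +-mono-≤ (mgf-bound-with-excess k y-bd) ≤-refl ⟩
      exp ((fromℕ 2 + curvature * 1/1+ k) * y ²) - E
        ≈⟨ +-congʳ (trans (exp-cong (solve 3 (λ c e y → (κ 2 :+ c :* e) :* (y :* y)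
             := κ 2 :* (y :* y) :+ c :* (y :* y) :* e) refl curvature (1/1+ k) y)) (exp-+ _ _)) ⟩
      E * exp (z * 1/1+ k) - E
        ≤⟨ +-mono-≤ (*-monoˡ-≤ (exp-nonneg _) (exp-quadratic-bound (small k))) ≤-refl ⟩
      E * (1# + z * 1/1+ k + (z * 1/1+ k) ² * exp z) - E
        ≈⟨ solve 4 (λ E z e x → E :* (κ 1 :+ z :* e :+ z :* e :* (z :* e) :* x) :- E
             := E :* (z :* e :+ z :* z :* x :* (e :* e))) refl E z (1/1+ k) (exp z) ⟩
      E * (z * 1/1+ k + z ² * exp z * (1/1+ k * 1/1+ k))
        ≤⟨ *-monoˡ-≤ (exp-nonneg _) (+-monoʳ-≤ _ (*-monoˡ-≤ (*-nonneg (²-nonneg z) (exp-nonneg z))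
             (*-monoʳ-≤ (0≤1/1+ k) (1/1+≤1 k)))) ⟩
      E * (z * 1/1+ k + z ² * exp z * (1# * 1/1+ k))
        ≈⟨ solve 4 (λ E z e x → E :* (z :* e :+ z :* z :* x :* (κ 1 :* e)) := E :* (z :+ z :* z :* x) :* e) refl E z (1/1+ k) (exp z) ⟩
      E * (z + z ² * exp z) * 1/1+ k ∎
      where
      E = exp (fromℕ 2 * y ²)
      z = curvature * y ²
      0≤z : 0# ≤ z
      0≤z = *-nonneg 0≤curvature (²-nonneg y)
      small : ∀ k → Bounded (z * 1/1+ k) z
      small k = bounded-of-nonneg (*-nonneg 0≤z (0≤1/1+ k))
        (≤-respʳ-≈ (*-identityʳ z) (*-monoˡ-≤ 0≤z (1/1+≤1 k)))

-- Finite additivity and splitting by Bernoulli values.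

module FiniteProbability {c ℓ o e} (ℝ : RealField c ℓ) (𝓟 : Probability.ProbabilitySpace ℝ o e) where

  open RealField ℝ
  open RealProperties ℝ hiding (exp)
  open Probability ℝ
  open ProbabilitySpace 𝓟
  open IntegerSolver ℝ
  open Limits ℝ
  open PartialOrderReasoning poset

  -- Infinitely many copies of an empty event are pairwise disjoint with union the event itself, and
  -- two of them already give ℙ + ℙ ≤ ℙ.
  ℙ-∅ : ∀ {A} (a : IsEvent A) → Empty A → ℙ a ≈ 0#
  ℙ-∅ {A} a A-empty = antisym (+-cancelˡ-≤ (ℙ a) (begin
    ℙ a + ℙ a                    ≈⟨ +-congʳ (+-identityˡ _) ⟨
    (0# + ℙ a) + ℙ a             ≤⟨ partialSums≤limit {λ _ → ℙ a} (λ _ → ℙ-nonneg a)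
                                      (ℙ-additive (λ _ → a) (λ _ ω (x , _) → A-empty ω x)) 2 ⟩
    ℙ (⋃-event (λ _ → a))        ≈⟨ ℙ-cong _ a (proj₂ , (0 ,_)) ⟩
    ℙ a                          ≈⟨ +-identityʳ _ ⟨
    ℙ a + 0#                     ∎)) (ℙ-nonneg a)

  -- Countable additivity is applied to A, B followed by empty events. The union enters as any event
  -- `C` with the same points, so callers may supply an event built in another way.
  ℙ-∪ : ∀ {A B C} (a : IsEvent A) (b : IsEvent B) (c : IsEvent C) →
        Empty (A ∩ B) → C ≐ A ∪ B → ℙ c ≈ ℙ a + ℙ b
  ℙ-∪ {A} {B} {C} a b c disjoint (C⊆ , ⊆C) = begin-equality
    ℙ c                   ≈⟨ ℙ-cong c (⋃-event family-event) (to , from) ⟩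
    ℙ (⋃-event family-event)
      ≈⟨ limit-unique (ℙ-additive family-event (λ {i} {j} → family-disjoint i j)) (converges-const 2 sums) (λ _ → refl) ⟩
    ℙ a + ℙ b             ∎
    where
    family : ℕ → Pred Ω ℓ
    family 0             = A
    family 1             = B
    family (suc (suc _)) = ∁ U

    family-event : ∀ i → IsEvent (family i)
    family-event 0             = a
    family-event 1             = b
    family-event (suc (suc _)) = ∁-event U-event

    family-disjoint : ∀ i j → i ≢ j → Empty (family i ∩ family j)
    family-disjoint 0 0 0≢0 = contradiction ≡.refl 0≢0
    family-disjoint 0 1 _ = disjoint
    family-disjoint 1 0 _ ω (y , x) = disjoint ω (x , y)
    family-disjoint 1 1 1≢1 = contradiction ≡.refl 1≢1
    family-disjoint (suc (suc _)) j _ ω (¬u , _) = ¬u tt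
    family-disjoint 0 (suc (suc _)) _ ω (_ , ¬u) = ¬u tt
    family-disjoint 1 (suc (suc _)) _ ω (_ , ¬u) = ¬u tt

    to : C ⊆ ⋃ ℕ family
    to x = [ (0 ,_) , (1 ,_) ]′ (C⊆ x)

    from : ⋃ ℕ family ⊆ C
    from (0 , x)             = ⊆C (inj₁ x)
    from (1 , x)             = ⊆C (inj₂ x)
    from (suc (suc _) , ¬u)  = contradiction tt ¬u

    sums : ∀ n → 2 ≤ℕ n → partialSums (λ i → ℙ (family-event i)) n ≈ ℙ a + ℙ b
    sums (suc zero)          (ℕ.s≤s ())
    sums (suc (suc zero))    _ = +-congʳ (+-identityˡ _)
    sums (suc (suc (suc n))) _ = trans
      (+-cong (sums (suc (suc n)) (ℕ.s≤s (ℕ.s≤s ℕ.z≤n))) (ℙ-∅ (∁-event U-event) (λ _ ¬u → ¬u tt)))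
      (+-identityʳ _)

  ℙ-split : ∀ {A D} (a : IsEvent A) (d : IsEvent D) → Decidable D →
            ℙ a ≈ ℙ (∩-event a d) + ℙ (∩-event a (∁-event d))
  ℙ-split {A} {D} a d D? = ℙ-∪ (∩-event a d) (∩-event a (∁-event d)) a
    (λ { _ ((_ , x) , (_ , ¬x)) → ¬x x }) (to , [ proj₁ , proj₁ ]′)
    where
    to : A ⊆ (A ∩ D) ∪ (A ∩ ∁ D)
    to {ω} x with D? ω
    ... | yes y = inj₁ (x , y)
    ... | no ¬y = inj₂ (x , ¬y)

  -- Without excluded middle B ∖ A is a complement of A in B only for decidable A.
  ℙ-mono : ∀ {A B} (a : IsEvent A) (b : IsEvent B) → Decidable A → A ⊆ B → ℙ a ≤ ℙ b
  ℙ-mono {A} {B} a b A? A⊆B = begin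
    ℙ a                                          ≈⟨ +-identityʳ _ ⟨
    ℙ a + 0#                                     ≤⟨ +-mono-≤ (≤-reflexive (ℙ-cong a (∩-event b a) ((λ x → A⊆B x , x) , proj₂))) (ℙ-nonneg _) ⟩
    ℙ (∩-event b a) + ℙ (∩-event b (∁-event a))  ≈⟨ ℙ-split b a A? ⟨
    ℙ b                                          ∎

  bit : Bool → Carrier
  bit true  = 1#
  bit false = 0#

  bit-borel : ∀ b → Borel (_≈ bit b)
  bit-borel true  = singleton 1#
  bit-borel false = singleton 0#

  takes : RandomVariable → Bool → Pred Ω ℓ
  takes X b = value X ⊢ (_≈ bit b)

  takes-event : ∀ X b → IsEvent (takes X b)
  takes-event X b = measurable X (bit-borel b)

  takes? : ∀ X b → Decidable (takes X b)
  takes? X b ω = value X ω ≟ bit b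

  -- The part of A on which X is neither 1 nor 0: `X ∼b p` makes it null but not empty, so it has to
  -- be carried through the splitting.
  neither : RandomVariable → Pred Ω ℓ → Pred Ω ℓ
  neither X A = (A ∩ ∁ (takes X true)) ∩ ∁ (takes X false)

  neither-event : ∀ X {A} → IsEvent A → IsEvent (neither X A)
  neither-event X a = ∩-event (∩-event a (∁-event (takes-event X true))) (∁-event (takes-event X false))

  ℙ-split-by-value : ∀ X {A} (a : IsEvent A) → ℙ a ≈
    ℙ (∩-event a (takes-event X true)) + (ℙ (∩-event a (takes-event X false)) + ℙ (neither-event X a))
  ℙ-split-by-value X a = trans (ℙ-split a (takes-event X true) (takes? X true))
    (+-congˡ (trans (ℙ-split (∩-event a (∁-event (takes-event X true))) (takes-event X false) (takes? X false))
      (+-congʳ (ℙ-cong _ _ ((λ { ((x , _) , y) → x , y }) ,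
        (λ { (x , y) → (x , λ z → 1≉0 (trans (sym z) y)) , y }))))))

  -- The masses p and 1 - p already exhaust ℙ U = 1.
  bernoulli-neither : ∀ X {p} → X ∼b p → ℙ (neither-event X U-event) ≈ 0#
  bernoulli-neither X {p} (is-p , is-1-p) = begin-equality
    N                                    ≈⟨ solve 2 (λ p n → n := p :+ (κ 1 :- p :+ n) :- κ 1) refl p N ⟩
    p + (1# - p + N) - 1#                ≈⟨ +-congʳ (+-cong (on-U true is-p) (+-congʳ (on-U false is-1-p))) ⟨
    ℙ (∩-event U-event (takes-event X true)) + (ℙ (∩-event U-event (takes-event X false)) + N) - 1#
                                         ≈⟨ +-congʳ (ℙ-split-by-value X U-event) ⟨
    ℙ U-event - 1#                       ≈⟨ +-congʳ ℙ-U ⟩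
    1# - 1#                              ≈⟨ -‿inverseʳ 1# ⟩
    0#                                   ∎
    where
    N = ℙ (neither-event X U-event)
    on-U : ∀ b {x} → ℙ (takes-event X b) ≈ x → ℙ (∩-event U-event (takes-event X b)) ≈ x
    on-U b eq = trans (ℙ-cong _ _ (proj₂ , (tt ,_))) eq

  ℙ≤split-bernoulli : ∀ X {p} → X ∼b p → ∀ {A} (a : IsEvent A) → Decidable A →
    ℙ a ≤ ℙ (∩-event a (takes-event X true)) + ℙ (∩-event a (takes-event X false))
  ℙ≤split-bernoulli X X∼b a A? = begin
    ℙ a                                       ≈⟨ ℙ-split-by-value X a ⟩
    T + (F + ℙ (neither-event X a))           ≤⟨ +-monoʳ-≤ T (+-monoʳ-≤ F (≤-respʳ-≈ (bernoulli-neither X X∼b)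
      (ℙ-mono (neither-event X a) (neither-event X U-event)
        (λ ω → (A? ω ×-dec ¬? (takes? X true ω)) ×-dec ¬? (takes? X false ω))
        (λ { ((_ , y) , z) → (tt , y) , z })))) ⟩
    T + (F + 0#)                              ≈⟨ +-congˡ (+-identityʳ F) ⟩
    T + F                                     ∎
    where
    T = ℙ (∩-event a (takes-event X true))
    F = ℙ (∩-event a (takes-event X false))

  cubeSum : ∀ n → (Vector Bool n → Carrier) → Carrier
  cubeSum zero    f = f []
  cubeSum (suc n) f = cubeSum n (λ v → f (true ∷ v)) + cubeSum n (λ v → f (false ∷ v))

  cubeSum-scale : ∀ x n f → cubeSum n (λ v → x * f v) ≈ x * cubeSum n f
  cubeSum-scale x zero    f = refl
  cubeSum-scale x (suc n) f =
    trans (+-cong (cubeSum-scale x n _) (cubeSum-scale x n _)) (sym (distribˡ _ _ _))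

  -- This takes the place of integration: it suffices to bound events on which every `X i` has a
  -- prescribed value. The bound is asked of every decidable `B ⊆ A`, since the induction replaces A
  -- by its intersection with a value of the first variable.
  ℙ≤cubeSum : ∀ {p n} (X : Vector RandomVariable n) → (∀ i → X i ∼b p) →
    ∀ {A} (a : IsEvent A) → Decidable A → (f : Vector Bool n → Carrier) →
    (∀ v {B} (b : IsEvent B) → Decidable B → B ⊆ A → (∀ {ω} → B ω → ∀ i → takes (X i) (v i) ω) → ℙ b ≤ f v) →
    ℙ a ≤ cubeSum n f
  ℙ≤cubeSum {n = zero}  X X∼b a A? f bound = bound [] a A? id (λ _ ())
  ℙ≤cubeSum {n = suc n} X X∼b {A} a A? f bound = begin
    ℙ a  ≤⟨ ℙ≤split-bernoulli (X zero) (X∼b zero) a A? ⟩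
    ℙ (∩-event a (takes-event (X zero) true)) + ℙ (∩-event a (takes-event (X zero) false))
         ≤⟨ +-mono-≤ (branch true) (branch false) ⟩
    cubeSum (suc n) f ∎
    where
    branch : ∀ b → ℙ (∩-event a (takes-event (X zero) b)) ≤ cubeSum n (λ v → f (b ∷ v))
    branch b = ℙ≤cubeSum (X ∘ suc) (X∼b ∘ suc) (∩-event a (takes-event (X zero) b))
      (λ ω → A? ω ×-dec takes? (X zero) b ω) (λ v → f (b ∷ v))
      λ v ev B? B⊆ vals → bound (b ∷ v) ev B? (proj₁ ∘ B⊆)
        λ { x zero → proj₂ (B⊆ x) ; x (suc i) → vals x i }

-- The Chernoff bound on the cube of outcomes.

module HoeffdingInequality {c ℓ o e} (ℝ : RealField c ℓ)
  (exp : RealField.Carrier ℝ → RealField.Carrier ℝ)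
  (exp-limit : ∀ x → RealField._ConvergesTo_ ℝ (RealField.partialSums ℝ (RealProperties.expTerm ℝ x)) (exp x))
  (𝓟 : Probability.ProbabilitySpace ℝ o e)
  where

  open RealField ℝ
  open RealProperties ℝ hiding (exp)
  open Probability ℝ
  open ProbabilitySpace 𝓟
  open IntegerSolver ℝ
  open Limits ℝ
  open Exponential ℝ exp exp-limit
  open HoeffdingLemma ℝ exp exp-limit
  open FiniteProbability ℝ 𝓟
  open PartialOrderReasoning poset
  open RawMonoidDefinitions +-rawMonoid using (sum)
  open RawMonoidDefinitions *-rawMonoid using () renaming (sum to product)

  sum-cong : ∀ {n} {f g : Vector Carrier n} → (∀ i → f i ≈ g i) → sum f ≈ sum g
  sum-cong {zero}  eq = refl
  sum-cong {suc n} eq = +-cong (eq zero) (sum-cong (eq ∘ suc))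

  product-cong : ∀ {n} {f g : Vector Carrier n} → (∀ i → f i ≈ g i) → product f ≈ product g
  product-cong {zero}  eq = refl
  product-cong {suc n} eq = *-cong (eq zero) (product-cong (eq ∘ suc))

  -- Summing a product over the cube factorises into (g true + g false)ⁿ, the finite form of the
  -- product rule for the expectation of an exponential of a sum.
  cubeSum-product-bound : ∀ (g : Bool → Carrier) {y} → 0# ≤ g true + g false → g true + g false ≤ exp y →
    ∀ n → cubeSum n (λ v → product (g ∘ v)) ≤ exp (fromℕ n * y)
  cubeSum-product-bound g {y} 0≤s s≤ zero    = ≤-reflexive (sym (trans (exp-cong (zeroˡ y)) exp-0))
  cubeSum-product-bound g {y} 0≤s s≤ (suc n) = begin
    cubeSum n (λ v → g true * product (g ∘ v)) + cubeSum n (λ v → g false * product (g ∘ v))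
      ≈⟨ +-cong (cubeSum-scale (g true) n _) (cubeSum-scale (g false) n _) ⟩
    g true * C + g false * C        ≈⟨ distribʳ _ _ _ ⟨
    (g true + g false) * C          ≤⟨ *-monoˡ-≤ 0≤s (cubeSum-product-bound g 0≤s s≤ n) ⟩
    (g true + g false) * exp (fromℕ n * y)  ≤⟨ *-monoʳ-≤ (exp-nonneg _) s≤ ⟩
    exp y * exp (fromℕ n * y)       ≈⟨ exp-+ _ _ ⟨
    exp (y + fromℕ n * y)           ≈⟨ exp-cong (solve 2 (λ y m → y :+ m :* y := (κ 1 :+ m) :* y) refl y (fromℕ n)) ⟩
    exp (fromℕ (suc n) * y)         ∎
    where C = cubeSum n (λ v → product (g ∘ v))

  weight : Carrier → Bool → Carrier
  weight p true  = p
  weight p false = 1# - p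

  Pr-takes : ∀ X {p} → X ∼b p → ∀ b → Pr X (bit-borel b) ≈ weight p b
  Pr-takes X (is-p , _)   true  = is-p
  Pr-takes X (_ , is-1-p) false = is-1-p

  -- Independence enters here, with the singletons of 0 and 1 as Borel sets.
  ℙ-outcome : ∀ {p n} (X : Vector RandomVariable n) → Independent X → (∀ i → X i ∼b p) → ∀ v →
    ℙ (⋂ᶠ-event (λ i → takes-event (X i) (v i))) ≈ product (λ i → weight p (v i))
  ℙ-outcome X independent X∼b v =
    trans (independent _ (bit-borel ∘ v)) (product-cong (λ i → Pr-takes (X i) (X∼b i) (v i)))

  -- The contribution of one coordinate to the mean of exp (t (Sₙ - rn)); the threshold rn is shared
  -- out as r per coordinate so that the product form survives.
  tilted : Carrier → Carrier → Carrier → Bool → Carrier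
  tilted p r t b = weight p b * exp (t * (bit b - r))

  product-tilted : ∀ p r t {n} (v : Vector Bool n) → product (tilted p r t ∘ v) ≈
    product (weight p ∘ v) * exp (t * (sum (bit ∘ v) - r * fromℕ n))
  product-tilted p r t {zero}  v = sym (trans (*-identityˡ _)
    (trans (exp-cong (solve 2 (λ t r → t :* (κ 0 :- r :* κ 0) := κ 0) refl t r)) exp-0))
  product-tilted p r t {suc n} v = begin-equality
    w * exp y * product (tilted p r t ∘ v ∘ suc)  ≈⟨ *-congˡ (product-tilted p r t (v ∘ suc)) ⟩
    w * exp y * (W * exp y′)                      ≈⟨ solve 4 (λ w y W y′ → w :* y :* (W :* y′) := w :* W :* (y :* y′)) refl _ _ _ _ ⟩
    w * W * (exp y * exp y′)                      ≈⟨ *-congˡ (exp-+ _ _) ⟨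
    w * W * exp (y + y′)                          ≈⟨ *-congˡ (exp-cong (solve 5 (λ t r b s m →
                                                       t :* (b :- r) :+ t :* (s :- r :* m) := t :* (b :+ s :- r :* (κ 1 :+ m)))
                                                       refl t r (bit (v zero)) (sum (bit ∘ v ∘ suc)) (fromℕ n))) ⟩
    product (weight p ∘ v) * exp (t * (sum (bit ∘ v) - r * fromℕ (suc n))) ∎
    where
    w  = weight p (v zero)
    W  = product (weight p ∘ v ∘ suc)
    y  = t * (bit (v zero) - r)
    y′ = t * (sum (bit ∘ v ∘ suc) - r * fromℕ n)

  hoeffding : ∀ {n p} → 0# ≤ p → p ≤ 1# →
    (X : Vector RandomVariable n) → Independent X → (∀ i → X i ∼b p) →
    ∀ {r} → p ≤ r → r ≤ 1# →
    Pr (∑ X) (upper-half-line (r * fromℕ n)) ≤ exp (- (fromℕ 2 * fromℕ n * (r - p) ²))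
  hoeffding {n} {p} 0≤p p≤1 X independent X∼b {r} p≤r r≤1 = begin
    Pr (∑ X) (upper-half-line (r * fromℕ n))
      ≤⟨ ℙ≤cubeSum X X∼b (measurable (∑ X) (upper-half-line (r * fromℕ n)))
           (λ ω → r * fromℕ n ≤? value (∑ X) ω) (λ v → product (tilted p r t ∘ v)) outcome-bound ⟩
    cubeSum n (λ v → product (tilted p r t ∘ v))
      ≤⟨ cubeSum-product-bound (tilted p r t)
           (+-nonneg (*-nonneg 0≤p (exp-nonneg _)) (*-nonneg (x≤y⇒0≤y-x p≤1) (exp-nonneg _))) mean≤ n ⟩
    exp (fromℕ n * - (fromℕ 2 * d ²))
      ≈⟨ exp-cong (solve 2 (λ n d → n :* :- (κ 2 :* (d :* d)) := :- (κ 2 :* n :* (d :* d))) refl (fromℕ n) d) ⟩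
    exp (- (fromℕ 2 * fromℕ n * d ²)) ∎
    where
    d = r - p
    -- Hoeffding's lemma yields the exponent t² / 8 - t d per variable, minimal at t = 4d with value
    -- -2d². In the scaling of `mgf` this is the argument d, which lies in [0,1].
    t = fromℕ 4 * d
    0≤d : 0# ≤ d
    0≤d = x≤y⇒0≤y-x p≤r
    d≤1 : d ≤ 1#
    d≤1 = ≤-from-difference (+-nonneg (x≤y⇒0≤y-x r≤1) 0≤p)
      (solve 2 (λ p r → κ 1 :- (r :- p) := κ 1 :- r :+ p) refl p r)

    mean≤ : tilted p r t true + tilted p r t false ≤ exp (- (fromℕ 2 * d ²))
    mean≤ = begin
      p * exp (t * (1# - r)) + (1# - p) * exp (t * (0# - r))
        -- Recentring from r to p: t (b - r) = t (b - p) - t d, and t d = 4d² gives the common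
        -- factor `s`.
        ≈⟨ +-cong (*-congˡ (trans (exp-cong (solve 2 (λ p r → let d = r :- p in κ 4 :* d :* (κ 1 :- r)
                     := κ 4 :* (κ 1 :- p) :* d :+ :- (κ 4 :* (d :* d))) refl p r)) (exp-+ _ _)))
                  (*-congˡ (trans (exp-cong (solve 2 (λ p r → let d = r :- p in κ 4 :* d :* (κ 0 :- r)
                     := :- (κ 4 :* p :* d) :+ :- (κ 4 :* (d :* d))) refl p r)) (exp-+ _ _))) ⟩
      p * (_ * s) + (1# - p) * (_ * s)
        ≈⟨ solve 5 (λ p q a b s → p :* (a :* s) :+ q :* (b :* s) := (p :* a :+ q :* b) :* s) refl p (1# - p) _ _ s ⟩
      mgf p d * s
        ≤⟨ *-monoʳ-≤ (exp-nonneg _) (mgf-bound 0≤p p≤1 (bounded-of-nonneg 0≤d d≤1)) ⟩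
      exp (fromℕ 2 * d ²) * s
        ≈⟨ exp-+ _ _ ⟨
      exp (fromℕ 2 * d ² - fromℕ 4 * d ²)
        ≈⟨ exp-cong (solve 1 (λ d → κ 2 :* (d :* d) :- κ 4 :* (d :* d) := :- (κ 2 :* (d :* d))) refl d) ⟩
      exp (- (fromℕ 2 * d ²)) ∎
      where s = exp (- (fromℕ 4 * d ²))

    outcome-bound : ∀ v {B} (b : IsEvent B) → Decidable B → B ⊆ (λ ω → r * fromℕ n ≤ value (∑ X) ω) →
      (∀ {ω} → B ω → ∀ i → takes (X i) (v i) ω) → ℙ b ≤ product (tilted p r t ∘ v)
    outcome-bound v {B} b B? B⊆ vals with r * fromℕ n ≤? sum (bit ∘ v)
    -- On an outcome inside the event the exponent is nonnegative, so tilting only increases its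
    -- weight.
    ... | yes le = begin
      ℙ b              ≤⟨ ℙ-mono b outcome B? vals ⟩
      ℙ outcome        ≈⟨ ℙ-outcome X independent X∼b v ⟩
      W                ≈⟨ *-identityʳ W ⟨
      W * 1#           ≤⟨ *-monoˡ-≤ 0≤W (1≤exp (*-nonneg (*-nonneg (0≤fromℕ 4) 0≤d) (x≤y⇒0≤y-x le))) ⟩
      W * exp (t * (sum (bit ∘ v) - r * fromℕ n)) ≈⟨ product-tilted p r t v ⟨
      product (tilted p r t ∘ v) ∎
      where
      W = product (weight p ∘ v)
      outcome = ⋂ᶠ-event (λ i → takes-event (X i) (v i))
      0≤W : 0# ≤ W
      0≤W = ≤-respʳ-≈ (ℙ-outcome X independent X∼b v) (ℙ-nonneg outcome)
    -- On `B` the sum equals that of the prescribed bits, which misses the threshold; `B` is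
    -- therefore empty.
    ... | no  gt = begin
      ℙ b              ≈⟨ ℙ-∅ b (λ ω x → gt (≤-respʳ-≈ (sum-cong (vals x)) (B⊆ x))) ⟩
      0#               ≤⟨ *-nonneg (≤-respʳ-≈ (ℙ-outcome X independent X∼b v) (ℙ-nonneg _)) (exp-nonneg _) ⟩
      product (weight p ∘ v) * exp (t * (sum (bit ∘ v) - r * fromℕ n)) ≈⟨ product-tilted p r t v ⟨
      product (tilted p r t ∘ v) ∎

-- Transfer of the bound to the exponential of the theorem.

exp-converges : ∀ {c ℓ} (ℝ : RealField c ℓ) →
    let open RealField ℝ
        open RealProperties ℝ
    in ∀ x → partialSums (expTerm x) ConvergesTo exp x
exp-converges ℝ x = proj₂ (complete (partialSums (expTerm x)) (expSeries-cauchy x))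
  where
  open RealField ℝ
  open RealProperties ℝ

≤exp⇒≤limit : ∀ {c ℓ} (ℝ : RealField c ℓ) →
    let open RealField ℝ
        open RealProperties ℝ
    in ∀ {x y l} → x ≤ RealProperties.exp ℝ y → partialSums (expTerm y) ConvergesTo l → x ≤ l
≤exp⇒≤limit ℝ {y = y} x≤exp y→l = RealProperties.≤-trans ℝ x≤exp
  (RealProperties.≤-reflexive ℝ
    (Limits.limit-unique ℝ (exp-converges ℝ y) y→l (λ _ → RealField.refl ℝ)))

lemma4 : ∀ {c ℓ o e} (ℝ : RealField c ℓ) →
    let open RealField ℝ
        open RealProperties ℝ
        open Probability ℝ
    in (𝓟 : ProbabilitySpace o e) →
    let open ProbabilitySpace 𝓟
    in (n : ℕ) → 1 ≤ℕ n →
       (p : Carrier) → 0# < p → p < 1# →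
       (X : Vector RandomVariable n) → Independent X → (∀ i → X i ∼b p) →
       (r : Carrier) → p < r → r < 1# →
       Pr (∑ X) (upper-half-line (r * fromℕ n)) ≤ exp (- (fromℕ 2 * fromℕ n * (r - p) ²))
-- Comparing the two copies of exp by conversion would unfold the proof that the
-- exponential series is Cauchy; uniqueness of limits identifies them instead.
lemma4 ℝ 𝓟 n _ p (0≤p , _) (p≤1 , _) X independent X∼b r (p≤r , _) (r≤1 , _) =
  ≤exp⇒≤limit ℝ
    (HoeffdingInequality.hoeffding ℝ (RealProperties.exp ℝ) (exp-converges ℝ) 𝓟
      {n} {p} 0≤p p≤1 X independent X∼b {r} p≤r r≤1)
    (proj₂ (RealField.complete ℝ _ _))
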